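{- The following two statements are equivalent. (1) (Sensitivity Conjecture) There exists a univariate real polynomial $p$ such that for every $n\ge 1$ and every Boolean function $f:\{0,1\}^n\to\{0,1\}$, $bs(f)\le p(s(f))$. (2) There exists a univariate real polynomial $q$ such that for every $n\ge 1$ and every Boolean function $f:\{0,1\}^n\to\{0,1\}$, $\log \operatorname{rank}[f(x\oplus y)]\le q(s(f))$.
   Context: For $B\subseteq[n]=\{1,\dots,n\}$ let $e_B\in\{0,1\}^n$ be the characteristic vector of $B$, and let $e_i=e_{\{i\}}$. Let $\oplus$ denote bitwise XOR on $\{0,1\}^n$. For $f$ on $\{0,1\}^n$ and $x\in\{0,1\}^n$, the sensitivity $s(f,x)$ is the number of $i\in[n]$ with $f(x\oplus e_i)\ne f(x)$, and $s(f)=\max_x s(f,x)$. A block $B\subseteq[n]$ is sensitive for $f$ on $x$ if $f(x\oplus e_B)\neq f(x)$. The block sensitivity $bs(f,x)$ is the maximum number of pairwise disjoint sensitive blocks of $f$ on $x$, and $bs(f)=\max_x bs(f,x)$. $\operatorname{rank}[f(x\oplus y)]$ denotes the rank over $\mathbb{R}$ of the $2^n\times 2^n$ matrix $M$ with rows and columns indexed by $x,y\in\{0,1\}^n$ and entries $M_{x,y}=f(x\oplus y)$. Logarithms are base 2, with $\log 0=-\infty$ (relevant only for $f\equiv 0$). The polynomials $p$ and $q$ do not depend on $n$ or $f$. -}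

module Defs where

open import Algebra.Bundles using (CommutativeRing)
import Algebra.Properties.Semiring.Sum
open import Data.Bool.Base using (Bool; true; false; _xor_)
import Data.Bool.Properties as Bool
open import Data.Fin.Base using (Fin; zero; suc; punchIn; punchOut)
open import Data.Fin.Properties as Fin using (any?; punchIn-punchOut)
open import Data.Fin.Subset using (Subset; ⁅_⁆; _∩_; Empty)
open import Data.Fin.Subset.Properties using (nonempty?)
open import Data.Integer.Base as ℤ using (+_; +[1+_]; +0; -[1+_])
import Data.Integer.Properties as ℤ
open import Data.List.Base using
  (List; []; _∷_; _++_; map; filter; length; lookup; allFin; foldr)
open import Data.List.Extrema.Nat using (max)
open import Data.List.Membership.Propositional using (_∈_)
open import Data.List.Membership.Propositional.Properties using (∈-map⁺; ∈-++⁺ˡ; ∈-++⁺ʳ)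
open import Data.List.Relation.Unary.All as All using (All)
open import Data.List.Relation.Unary.AllPairs as AllPairs using (AllPairs)
open import Data.List.Relation.Unary.Any using (here; there)
open import Data.Nat.Base as ℕ using (ℕ; zero; suc)
import Data.Nat.Properties as ℕ
open import Data.Nat.Logarithm using
  (⌊log₂_⌋; ⌊log₂⌋-mono-≤; ⌊log₂[2^n]⌋≡n; ⌊log₂⌊n/2⌋⌋≡⌊log₂n⌋∸1)
open import Data.Product.Base using (_×_; _,_; proj₁; proj₂; ∃; ∃-syntax)
open import Data.Rational.Base hiding (truncate)
open import Data.Rational.Properties
open import Data.Rational.Solver using (module +-*-Solver)
import Data.Rational.Unnormalised.Base as ℚᵘ
import Data.Rational.Unnormalised.Properties as ℚᵘ
open import Data.Sum.Base using (inj₁; inj₂)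
open import Data.Vec.Base as Vec using (Vec; zipWith)
open import Data.Vec.Functional using (removeAt; insertAt)
open import Data.Vec.Functional.Properties using (insertAt-lookup; insertAt-punchIn)
open import Function.Base using (_∘_)
open import Level using (0ℓ)
import Relation.Binary.Construct.Add.Infimum.NonStrict as NonStrict
open import Relation.Binary.PropositionalEquality hiding ([_]; setoid)
open import Relation.Nullary.Construct.Add.Infimum using (_₋; ⊥₋; [_])
open import Relation.Nullary.Decidable using (Dec; yes; no; ¬?; map′; decidable-stable; _×-dec_)
open import Relation.Nullary.Negation using (¬_; contradiction)
open import Relation.Unary using (Decidable)

Cauchy : (ℕ → ℚ) → Set
Cauchy x = ∀ ε → ε > 0ℚ → ∃[ N ] ∀ m n → m ℕ.≥ N → n ℕ.≥ N → ∣ x m - x n ∣ < ε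

record ℝ : Set where
  no-eta-equality
  constructor mkℝ
  field
    seq    : ℕ → ℚ
    cauchy : Cauchy seq

open ℝ public

infix 4 _≈ᴿ_ _≤ᴿ_

record _≈ᴿ_ (x y : ℝ) : Set where
  constructor mk≈
  field
    ≈-limit : ∀ ε → ε > 0ℚ → ∃[ N ] ∀ n → n ℕ.≥ N → ∣ seq x n - seq y n ∣ < ε

record _≤ᴿ_ (x y : ℝ) : Set where
  constructor mk≤
  field
    ≤-limit : ∀ ε → ε > 0ℚ → ∃[ N ] ∀ n → n ℕ.≥ N → seq x n ≤ seq y n + ε

open _≈ᴿ_ public
open _≤ᴿ_ public

Vanishing : (ℕ → ℕ → ℚ) → Set
Vanishing u = ∀ ε → ε > 0ℚ → ∃[ N ] ∀ m n → m ℕ.≥ N → n ℕ.≥ N → ∣ u m n ∣ < ε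

EventuallyBounded : (ℕ → ℕ → ℚ) → Set
EventuallyBounded u =
  ∃[ K ] K > 0ℚ × ∃[ N ] ∀ m n → m ℕ.≥ N → n ℕ.≥ N → ∣ u m n ∣ ≤ K

vanishing-cong : ∀ {u v} → (∀ m n → u m n ≡ v m n) → Vanishing u → Vanishing v
vanishing-cong u≗v V ε ε>0 with V ε ε>0
... | N , H = N , λ m n p q → subst (λ t → ∣ t ∣ < ε) (u≗v m n) (H m n p q)

½*pos : ∀ {ε} → ε > 0ℚ → ½ * ε > 0ℚ
½*pos {ε} ε>0 = positive⁻¹ (½ * ε) {{pos*pos⇒pos ½ ε {{positive ε>0}}}}

½+½ : ∀ ε → ½ * ε + ½ * ε ≡ ε
½+½ ε = trans (sym (*-distribʳ-+ ε ½ ½)) (*-identityˡ ε)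

vanishing-+ : ∀ {u v} → Vanishing u → Vanishing v → Vanishing (λ m n → u m n + v m n)
vanishing-+ {u} {v} U V ε ε>0 with U (½ * ε) (½*pos ε>0) | V (½ * ε) (½*pos ε>0)
... | M , H | N , K = M ℕ.+ N , λ m n p q → ≤-<-trans (∣p+q∣≤∣p∣+∣q∣ (u m n) (v m n))
  (subst (∣ u m n ∣ + ∣ v m n ∣ <_) (½+½ ε)
    (+-mono-< (H m n (ℕ.m+n≤o⇒m≤o M p) (ℕ.m+n≤o⇒m≤o M q))
              (K m n (ℕ.m+n≤o⇒n≤o M p) (ℕ.m+n≤o⇒n≤o M q))))

vanishing-neg : ∀ {u} → Vanishing u → Vanishing (λ m n → - u m n)
vanishing-neg {u} U ε ε>0 with U ε ε>0
... | N , H = N , λ m n p q → subst (_< ε) (sym (∣-p∣≡∣p∣ (u m n))) (H m n p q)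

vanishing-* : ∀ {b u} → EventuallyBounded b → Vanishing u →
              Vanishing (λ m n → b m n * u m n)
vanishing-* {b} {u} (K , K>0 , M , B) U ε ε>0 = M ℕ.+ proj₁ small , bound
  where
  instance
    K-pos : Positive K
    K-pos = positive K>0
    K-nonNeg : NonNegative K
    K-nonNeg = pos⇒nonNeg K
    K-nonZero : NonZero K
    K-nonZero = pos⇒nonZero K
  δ : ℚ
  δ = 1/ K * ε
  δ>0 : δ > 0ℚ
  δ>0 = positive⁻¹ δ {{pos*pos⇒pos (1/ K) {{1/pos⇒pos K}} ε {{positive ε>0}}}}
  Kδ≡ε : K * δ ≡ ε
  Kδ≡ε = trans (sym (*-assoc K (1/ K) ε))
    (trans (cong (_* ε) (*-inverseʳ K)) (*-identityˡ ε))
  small : ∃[ N ] ∀ m n → m ℕ.≥ N → n ℕ.≥ N → ∣ u m n ∣ < δ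
  small = U δ δ>0
  bound : ∀ m n → m ℕ.≥ M ℕ.+ proj₁ small → n ℕ.≥ M ℕ.+ proj₁ small →
          ∣ b m n * u m n ∣ < ε
  bound m n p q = subst₂ _<_ (sym (∣p*q∣≡∣p∣*∣q∣ (b m n) (u m n))) Kδ≡ε
    (≤-<-trans
      (*-monoʳ-≤-nonNeg ∣ u m n ∣ {{∣-∣-nonNeg (u m n)}}
        (B m n (ℕ.m+n≤o⇒m≤o M p) (ℕ.m+n≤o⇒m≤o M q)))
      (*-monoʳ-<-pos K
        (proj₂ small m n (ℕ.m+n≤o⇒n≤o M p) (ℕ.m+n≤o⇒n≤o M q))))

eventually-bounded : ∀ {x} → Cauchy x →
  ∃[ K ] K > 0ℚ × ∃[ N ] ∀ n → n ℕ.≥ N → ∣ x n ∣ ≤ K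
eventually-bounded {x} C with C 1ℚ (positive⁻¹ 1ℚ)
... | N , H = 1ℚ + ∣ x N ∣ , K>0 , N , bound
  where
  K>0 : 1ℚ + ∣ x N ∣ > 0ℚ
  K>0 = +-mono-<-≤ (positive⁻¹ 1ℚ) (0≤∣p∣ (x N))
  bound : ∀ n → n ℕ.≥ N → ∣ x n ∣ ≤ 1ℚ + ∣ x N ∣
  bound n p = subst (λ t → ∣ t ∣ ≤ 1ℚ + ∣ x N ∣) (lemma (x n) (x N))
    (≤-trans (∣p+q∣≤∣p∣+∣q∣ (x n - x N) (x N))
      (+-monoˡ-≤ ∣ x N ∣ (<⇒≤ (H n N p ℕ.≤-refl))))
    where
    lemma : ∀ a b → a - b + b ≡ a
    lemma = solve 2 (λ a b → a :- b :+ b := a) refl where open +-*-Solver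

boundedˡ : ∀ x → EventuallyBounded (λ m _ → seq x m)
boundedˡ x = let K , K>0 , N , B = eventually-bounded (cauchy x) in
  K , K>0 , N , λ m _ p _ → B m p

boundedʳ : ∀ x → EventuallyBounded (λ _ n → seq x n)
boundedʳ x = let K , K>0 , N , B = eventually-bounded (cauchy x) in
  K , K>0 , N , λ _ n _ q → B n q

≈⇒vanishing : ∀ {x y} → x ≈ᴿ y → Vanishing (λ m _ → seq x m - seq y m)
≈⇒vanishing E ε ε>0 with ≈-limit E ε ε>0
... | N , H = N , λ m _ p _ → H m p

vanishing⇒≈ : ∀ {x y} → Vanishing (λ m _ → seq x m - seq y m) → x ≈ᴿ y
vanishing⇒≈ V = mk≈ λ ε ε>0 → proj₁ (V ε ε>0) , λ n p → proj₂ (V ε ε>0) n n p p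

pointwise⇒≈ : ∀ {x y} → (∀ n → seq x n ≡ seq y n) → x ≈ᴿ y
pointwise⇒≈ {x} {y} x≗y = mk≈ λ ε ε>0 → 0 , λ n _ → subst (λ t → ∣ t ∣ < ε)
  (sym (trans (cong (_- seq y n) (x≗y n)) (+-inverseʳ (seq y n)))) ε>0

fromℚ : ℚ → ℝ
fromℚ p .seq    = λ _ → p
fromℚ p .cauchy = λ ε ε>0 →
  0 , λ _ _ _ _ → subst (λ t → ∣ t ∣ < ε) (sym (+-inverseʳ p)) ε>0

fromℕ : ℕ → ℝ
fromℕ k = fromℚ (+ k / 1)

0ᴿ 1ᴿ : ℝ
0ᴿ = fromℚ 0ℚ
1ᴿ = fromℚ 1ℚ

infix  8 -ᴿ_
infixl 7 _*ᴿ_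
infixl 6 _+ᴿ_

_+ᴿ_ : ℝ → ℝ → ℝ
(x +ᴿ y) .seq    = λ n → seq x n + seq y n
(x +ᴿ y) .cauchy =
  vanishing-cong (λ m n → lemma (seq x m) (seq x n) (seq y m) (seq y n))
    (vanishing-+ (cauchy x) (cauchy y))
  where
  lemma : ∀ a b c d → (a - b) + (c - d) ≡ (a + c) - (b + d)
  lemma = solve 4 (λ a b c d → (a :- b) :+ (c :- d) := (a :+ c) :- (b :+ d)) refl
    where open +-*-Solver

-ᴿ_ : ℝ → ℝ
(-ᴿ x) .seq    = λ n → - seq x n
(-ᴿ x) .cauchy =
  vanishing-cong (λ m n → neg-distrib-+ (seq x m) (- seq x n)) (vanishing-neg (cauchy x))

_*ᴿ_ : ℝ → ℝ → ℝ
(x *ᴿ y) .seq    = λ n → seq x n * seq y n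
(x *ᴿ y) .cauchy =
  vanishing-cong (λ m n → lemma (seq x m) (seq x n) (seq y m) (seq y n))
    (vanishing-+
      (vanishing-* {λ m _ → seq x m} {λ m n → seq y m - seq y n} (boundedˡ x) (cauchy y))
      (vanishing-* {λ _ n → seq y n} {λ m n → seq x m - seq x n} (boundedʳ y) (cauchy x)))
  where
  lemma : ∀ a b c d → a * (c - d) + d * (a - b) ≡ a * c - b * d
  lemma = solve 4 (λ a b c d → a :* (c :- d) :+ d :* (a :- b) := a :* c :- b :* d) refl
    where open +-*-Solver

≈-refl : ∀ {x} → x ≈ᴿ x
≈-refl = pointwise⇒≈ (λ _ → refl)

≈-sym : ∀ {x y} → x ≈ᴿ y → y ≈ᴿ x
≈-sym {x} {y} x≈y = vanishing⇒≈
  (vanishing-cong (λ m _ → lemma (seq x m) (seq y m)) (vanishing-neg (≈⇒vanishing x≈y)))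
  where
  lemma : ∀ a b → - (a - b) ≡ b - a
  lemma = solve 2 (λ a b → :- (a :- b) := b :- a) refl where open +-*-Solver

≈-trans : ∀ {x y z} → x ≈ᴿ y → y ≈ᴿ z → x ≈ᴿ z
≈-trans {x} {y} {z} x≈y y≈z = vanishing⇒≈
  (vanishing-cong (λ m _ → lemma (seq x m) (seq y m) (seq z m))
    (vanishing-+ (≈⇒vanishing x≈y) (≈⇒vanishing y≈z)))
  where
  lemma : ∀ a b c → (a - b) + (b - c) ≡ a - c
  lemma = solve 3 (λ a b c → (a :- b) :+ (b :- c) := a :- c) refl where open +-*-Solver

+ᴿ-cong : ∀ {x x′ y y′} → x ≈ᴿ x′ → y ≈ᴿ y′ → x +ᴿ y ≈ᴿ x′ +ᴿ y′
+ᴿ-cong {x} {x′} {y} {y′} p q = vanishing⇒≈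
  (vanishing-cong (λ m _ → lemma (seq x m) (seq x′ m) (seq y m) (seq y′ m))
    (vanishing-+ (≈⇒vanishing p) (≈⇒vanishing q)))
  where
  lemma : ∀ a b c d → (a - b) + (c - d) ≡ (a + c) - (b + d)
  lemma = solve 4 (λ a b c d → (a :- b) :+ (c :- d) := (a :+ c) :- (b :+ d)) refl
    where open +-*-Solver

-ᴿ-cong : ∀ {x y} → x ≈ᴿ y → -ᴿ x ≈ᴿ -ᴿ y
-ᴿ-cong {x} {y} p = vanishing⇒≈
  (vanishing-cong (λ m _ → neg-distrib-+ (seq x m) (- seq y m))
    (vanishing-neg (≈⇒vanishing p)))

*ᴿ-cong : ∀ {x x′ y y′} → x ≈ᴿ x′ → y ≈ᴿ y′ → x *ᴿ y ≈ᴿ x′ *ᴿ y′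
*ᴿ-cong {x} {x′} {y} {y′} p q = vanishing⇒≈
  (vanishing-cong (λ m _ → lemma (seq x m) (seq x′ m) (seq y m) (seq y′ m))
    (vanishing-+
      (vanishing-* {λ m _ → seq x m} {λ m _ → seq y m - seq y′ m} (boundedˡ x) (≈⇒vanishing q))
      (vanishing-* {λ m _ → seq y′ m} {λ m _ → seq x m - seq x′ m} (boundedˡ y′) (≈⇒vanishing p))))
  where
  lemma : ∀ a b c d → a * (c - d) + d * (a - b) ≡ a * c - b * d
  lemma = solve 4 (λ a b c d → a :* (c :- d) :+ d :* (a :- b) := a :* c :- b :* d) refl
    where open +-*-Solver

ℝ-commutativeRing : CommutativeRing 0ℓ 0ℓ
ℝ-commutativeRing = record
  { Carrier = ℝ ; _≈_ = _≈ᴿ_ ; _+_ = _+ᴿ_ ; _*_ = _*ᴿ_ ; -_ = -ᴿ_ ; 0# = 0ᴿ ; 1# = 1ᴿ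
  ; isCommutativeRing = record
    { isRing = record
      { +-isAbelianGroup = record
        { isGroup = record
          { isMonoid = record
            { isSemigroup = record
              { isMagma = record
                { isEquivalence = record
                  { refl  = ≈-refl
                  ; sym   = ≈-sym
                  ; trans = ≈-trans
                  }
                ; ∙-cong = +ᴿ-cong
                }
              ; assoc = λ x y z → pointwise⇒≈ (λ n → +-assoc (seq x n) (seq y n) (seq z n))
              }
            ; identity = (λ x → pointwise⇒≈ (λ n → +-identityˡ (seq x n)))
                       , (λ x → pointwise⇒≈ (λ n → +-identityʳ (seq x n)))
            }
          ; inverse = (λ x → pointwise⇒≈ (λ n → +-inverseˡ (seq x n)))
                    , (λ x → pointwise⇒≈ (λ n → +-inverseʳ (seq x n)))
          ; ⁻¹-cong = -ᴿ-cong
          }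
        ; comm = λ x y → pointwise⇒≈ (λ n → +-comm (seq x n) (seq y n))
        }
      ; *-cong = *ᴿ-cong
      ; *-assoc = λ x y z → pointwise⇒≈ (λ n → *-assoc (seq x n) (seq y n) (seq z n))
      ; *-identity = (λ x → pointwise⇒≈ (λ n → *-identityˡ (seq x n)))
                   , (λ x → pointwise⇒≈ (λ n → *-identityʳ (seq x n)))
      ; distrib = (λ x y z → pointwise⇒≈ (λ n → *-distribˡ-+ (seq x n) (seq y n) (seq z n)))
                , (λ x y z → pointwise⇒≈ (λ n → *-distribʳ-+ (seq x n) (seq y n) (seq z n)))
      }
    ; *-comm = λ x y → pointwise⇒≈ (λ n → *-comm (seq x n) (seq y n))
    }
  }

module ℝ-ring = CommutativeRing ℝ-commutativeRing
module ℝ-sum = Algebra.Properties.Semiring.Sum ℝ-ring.semiring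

-- Coefficients, constant term first.
Polynomial : Set
Polynomial = List ℝ

eval : Polynomial → ℝ → ℝ
eval p x = foldr (λ a r → a +ᴿ x *ᴿ r) 0ᴿ p

n<2*suc⌊n/2⌋ : ∀ n → n ℕ.< 2 ℕ.* suc ℕ.⌊ n /2⌋
n<2*suc⌊n/2⌋ zero = ℕ.s≤s ℕ.z≤n
n<2*suc⌊n/2⌋ (suc zero) = ℕ.s≤s (ℕ.s≤s ℕ.z≤n)
n<2*suc⌊n/2⌋ (suc (suc n)) = subst (suc (suc n) ℕ.<_)
  (sym (ℕ.*-suc 2 (suc ℕ.⌊ n /2⌋))) (ℕ.s≤s (ℕ.s≤s (n<2*suc⌊n/2⌋ n)))

2*⌊n/2⌋≤n : ∀ n → 2 ℕ.* ℕ.⌊ n /2⌋ ℕ.≤ n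
2*⌊n/2⌋≤n zero = ℕ.z≤n
2*⌊n/2⌋≤n (suc zero) = ℕ.z≤n
2*⌊n/2⌋≤n (suc (suc n)) = subst (ℕ._≤ suc (suc n))
  (sym (ℕ.*-suc 2 ℕ.⌊ n /2⌋)) (ℕ.s≤s (ℕ.s≤s (2*⌊n/2⌋≤n n)))

2^≤ : ∀ l n → .{{ℕ.NonZero n}} → ⌊log₂ n ⌋ ≡ l → 2 ℕ.^ l ℕ.≤ n
2^≤ zero    (suc n) _ = ℕ.s≤s ℕ.z≤n
2^≤ (suc l) (suc zero) ()
2^≤ (suc l) n@(suc (suc m)) eq = ℕ.≤-trans
  (ℕ.*-monoʳ-≤ 2 (2^≤ l ℕ.⌊ n /2⌋ (trans (⌊log₂⌊n/2⌋⌋≡⌊log₂n⌋∸1 n) (cong ℕ.pred eq))))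
  (2*⌊n/2⌋≤n n)

2^⌊log₂n⌋≤n : ∀ n → .{{ℕ.NonZero n}} → 2 ℕ.^ ⌊log₂ n ⌋ ℕ.≤ n
2^⌊log₂n⌋≤n n = 2^≤ ⌊log₂ n ⌋ n refl

n<2^suc⌊log₂n⌋ : ∀ n → n ℕ.< 2 ℕ.^ suc ⌊log₂ n ⌋
n<2^suc⌊log₂n⌋ n = ℕ.≰⇒> λ le → ℕ.<-irrefl refl
  (subst (ℕ._≤ ⌊log₂ n ⌋) (⌊log₂[2^n]⌋≡n (suc ⌊log₂ n ⌋)) (⌊log₂⌋-mono-≤ le))

2^-cancel-≤ : ∀ {a b} → 2 ℕ.^ a ℕ.≤ 2 ℕ.^ b → a ℕ.≤ b
2^-cancel-≤ le = ℕ.≮⇒≥ λ b<a → ℕ.<⇒≱ (ℕ.^-monoʳ-< 2 (ℕ.s≤s (ℕ.s≤s ℕ.z≤n)) b<a) le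

cross : ∀ r → .{{ℕ.NonZero r}} → ∀ m n →
        ⌊log₂ r ℕ.^ m ⌋ ℕ.* n ℕ.≤ suc ⌊log₂ r ℕ.^ n ⌋ ℕ.* m
cross r m n = 2^-cancel-≤ (begin
  2 ℕ.^ (⌊log₂ r ℕ.^ m ⌋ ℕ.* n)      ≡⟨ sym (ℕ.^-*-assoc 2 ⌊log₂ r ℕ.^ m ⌋ n) ⟩
  (2 ℕ.^ ⌊log₂ r ℕ.^ m ⌋) ℕ.^ n      ≤⟨ ℕ.^-monoˡ-≤ n (2^⌊log₂n⌋≤n (r ℕ.^ m) {{ℕ.m^n≢0 r m}}) ⟩
  (r ℕ.^ m) ℕ.^ n                    ≡⟨ ℕ.^-*-assoc r m n ⟩
  r ℕ.^ (m ℕ.* n)                    ≡⟨ cong (r ℕ.^_) (ℕ.*-comm m n) ⟩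
  r ℕ.^ (n ℕ.* m)                    ≡⟨ sym (ℕ.^-*-assoc r n m) ⟩
  (r ℕ.^ n) ℕ.^ m                    ≤⟨ ℕ.^-monoˡ-≤ m (ℕ.<⇒≤ (n<2^suc⌊log₂n⌋ (r ℕ.^ n))) ⟩
  (2 ℕ.^ suc ⌊log₂ r ℕ.^ n ⌋) ℕ.^ m  ≡⟨ ℕ.^-*-assoc 2 (suc ⌊log₂ r ℕ.^ n ⌋) m ⟩
  2 ℕ.^ (suc ⌊log₂ r ℕ.^ n ⌋ ℕ.* m)  ∎)
  where open ℕ.≤-Reasoning

/-mono : ∀ a b m n → a ℕ.* suc n ℕ.≤ b ℕ.* suc m → + a / suc m ≤ + b / suc n
/-mono a b m n le = toℚᵘ-cancel-≤ (ℚᵘ.≤-respˡ-≃ (ℚᵘ.≃-sym (toℚᵘ-fromℚᵘ (ℚᵘ.mkℚᵘ (+ a) m)))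
  (ℚᵘ.≤-respʳ-≃ (ℚᵘ.≃-sym (toℚᵘ-fromℚᵘ (ℚᵘ.mkℚᵘ (+ b) n)))
    (ℚᵘ.*≤* (subst₂ ℤ._≤_ (ℤ.pos-* a (suc n)) (ℤ.pos-* b (suc m)) (ℤ.+≤+ le)))))

/-suc : ∀ a n → + suc a / suc n ≡ + a / suc n + + 1 / suc n
/-suc a n = toℚᵘ-injective (ℚᵘ.≃-trans (toℚᵘ-fromℚᵘ (ℚᵘ.mkℚᵘ (+ suc a) n))
  (ℚᵘ.≃-trans (ℚᵘ.*≡* eq)
  (ℚᵘ.≃-trans
    (ℚᵘ.+-cong (ℚᵘ.≃-sym (toℚᵘ-fromℚᵘ (ℚᵘ.mkℚᵘ (+ a) n)))
               (ℚᵘ.≃-sym (toℚᵘ-fromℚᵘ (ℚᵘ.mkℚᵘ (+ 1) n))))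
    (ℚᵘ.≃-sym (toℚᵘ-homo-+ (+ a / suc n) (+ 1 / suc n))))))
  where
  d = + suc n
  eq : + suc a ℤ.* (d ℤ.* d) ≡ (+ a ℤ.* d ℤ.+ + 1 ℤ.* d) ℤ.* d
  eq = trans (sym (ℤ.*-assoc (+ suc a) d d)) (cong (ℤ._* d)
    (trans (cong (λ t → + t ℤ.* d) (ℕ.+-comm 1 a)) (ℤ.*-distribʳ-+ d (+ a) (+ 1))))

archimedean : ∀ ε → ε > 0ℚ → ∃[ N ] ∀ n → n ℕ.≥ N → + 1 / suc n < ε
archimedean ε@(mkℚ +[1+ a ] d _) _ = suc d , λ n p →
  toℚᵘ-cancel-< (ℚᵘ.<-respˡ-≃ (ℚᵘ.≃-sym (toℚᵘ-fromℚᵘ (ℚᵘ.mkℚᵘ (+ 1) n)))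
    (ℚᵘ.*<* (subst (+ 1 ℤ.* + suc d ℤ.<_) (ℤ.pos-* (suc a) (suc n))
      (subst (ℤ._< + (suc a ℕ.* suc n)) (sym (ℤ.*-identityˡ (+ suc d)))
        (ℤ.+<+ (ℕ.≤-trans (ℕ.s≤s p) (ℕ.m≤m+n (suc n) (a ℕ.* suc n))))))))
archimedean (mkℚ +0       _ _) (*<* (ℤ.+<+ ()))
archimedean (mkℚ -[1+ _ ] _ _) (*<* ())

regular⇒cauchy : ∀ x → (∀ m n → x m ≤ x n + + 1 / suc n) → Cauchy x
regular⇒cauchy x R ε ε>0 with archimedean ε ε>0
... | N , H = N , λ m n p q → abs-< (x m) (x n) (below m n q) (below n m p)
  where
  cancel : ∀ a b → a + b - a ≡ b
  cancel = solve 2 (λ a b → a :+ b :- a := b) refl where open +-*-Solver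
  flip : ∀ a b → - (a - b) ≡ b - a
  flip = solve 2 (λ a b → :- (a :- b) := b :- a) refl where open +-*-Solver
  below : ∀ m n → n ℕ.≥ N → x m - x n < ε
  below m n q = ≤-<-trans
    (subst (x m - x n ≤_) (cancel (x n) (+ 1 / suc n)) (+-monoˡ-≤ (- x n) (R m n)))
    (H n q)
  abs-< : ∀ a b → a - b < ε → b - a < ε → ∣ a - b ∣ < ε
  abs-< a b lt gt with ∣p∣≡p∨∣p∣≡-p (a - b)
  ... | inj₁ eq = subst (_< ε) (sym eq) lt
  ... | inj₂ eq = subst (_< ε) (sym (trans eq (flip a b))) gt

-- For r ≥ 1, log₂ r is the limit of ⌊log₂ (rᵐ)⌋ / m, since
-- m · log₂ r - 1 < ⌊log₂ (rᵐ)⌋ ≤ m · log₂ r.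
log-seq : ℕ → ℕ → ℚ
log-seq r m = + ⌊log₂ r ℕ.^ suc m ⌋ / suc m

log-cauchy : ∀ r → .{{ℕ.NonZero r}} → Cauchy (log-seq r)
log-cauchy r = regular⇒cauchy (log-seq r) λ m n →
  subst (log-seq r m ≤_) (/-suc ⌊log₂ r ℕ.^ suc n ⌋ n)
    (/-mono ⌊log₂ r ℕ.^ suc m ⌋ (suc ⌊log₂ r ℕ.^ suc n ⌋) m n (cross r (suc m) (suc n)))

-- The added point ⊥₋ is -∞ = log₂ 0.
log₂ : ℕ → ℝ ₋
log₂ zero      = ⊥₋
log₂ r@(suc _) = [ mkℝ (log-seq r) (log-cauchy r) ]

infix 4 _≤₋_

_≤₋_ : ℝ ₋ → ℝ ₋ → Set
_≤₋_ = NonStrict._≤₋_ _≤ᴿ_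

LinearlyIndependent : ∀ {X : Set} {k} → (Fin k → X → ℝ) → Set
LinearlyIndependent {X} {k} v =
  (c : Fin k → ℝ) →
  (∀ x → ℝ-sum.sum (λ i → c i *ᴿ v i x) ≈ᴿ 0ᴿ) →
  ∀ i → c i ≈ᴿ 0ᴿ

-- Independence over ℝ is decidable here because the entries are rational.
module Elimination {X : Set} where

  open ℝ-ring using (setoid; +-congˡ; +-congʳ; +-cong; *-congˡ; *-congʳ)
    renaming (refl to ≈refl; sym to ≈sym; trans to ≈trans; reflexive to ≈reflexive)
  open ℝ-sum using (sum; sum-cong-≋; sum-remove; ∑-distrib-+; *-distribʳ-sum; sum-replicate-zero)
  open import Relation.Binary.Reasoning.Setoid setoid

  lin : ∀ {k} → (Fin k → X → ℚ) → (Fin k → ℝ) → X → ℝ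
  lin v c x = sum (λ i → c i *ᴿ fromℚ (v i x))

  IndependentOn : ∀ {k} → List X → (Fin k → X → ℚ) → Set
  IndependentOn xs v = ∀ c → (∀ {x} → x ∈ xs → lin v c x ≈ᴿ 0ᴿ) → ∀ i → c i ≈ᴿ 0ᴿ

  1≉0 : ¬ (1ᴿ ≈ᴿ 0ᴿ)
  1≉0 eq with ≈-limit eq ½ (positive⁻¹ ½)
  ... | N , H = <-asym (H N ℕ.≤-refl) (ℚ½<1)
    where
    ℚ½<1 : ½ < 1ℚ
    ℚ½<1 = *<* (ℤ.+<+ (ℕ.s≤s (ℕ.s≤s ℕ.z≤n)))

  module Pivot {k} (v : Fin (suc k) → X → ℚ) (x : X) (i : Fin (suc k))
               (a⁻¹ : ℚ) (a*a⁻¹≡1 : v i x * a⁻¹ ≡ 1ℚ) where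

    a : ℚ
    a = v i x

    u w : Fin k → X → ℚ
    u = removeAt v i
    w j y = u j y - u j x * (a⁻¹ * v i y)

    total : (Fin k → ℝ) → ℝ → X → ℝ
    total d t y = t *ᴿ fromℚ (v i y) +ᴿ lin u d y

    lin-total : ∀ c y → lin v c y ≈ᴿ total (removeAt c i) (c i) y
    lin-total c y = sum-remove {k} {i} (λ j → c j *ᴿ fromℚ (v j y))

    lin-w : ∀ d y → lin w d y ≈ᴿ lin u d y +ᴿ lin u d x *ᴿ fromℚ (- (a⁻¹ * v i y))
    lin-w d y = begin
      lin w d y
        ≈⟨ sum-cong-≋ (λ j → pointwise⇒≈ (λ n →
             lemma (seq (d j) n) (u j y) (u j x) (a⁻¹ * v i y))) ⟩
      sum (λ j → d j *ᴿ fromℚ (u j y) +ᴿ d j *ᴿ fromℚ (u j x) *ᴿ g)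
        ≈⟨ ∑-distrib-+ (λ j → d j *ᴿ fromℚ (u j y)) (λ j → d j *ᴿ fromℚ (u j x) *ᴿ g) ⟩
      lin u d y +ᴿ sum (λ j → d j *ᴿ fromℚ (u j x) *ᴿ g)
        ≈⟨ +-congˡ (*-distribʳ-sum g (λ j → d j *ᴿ fromℚ (u j x))) ⟨
      lin u d y +ᴿ lin u d x *ᴿ g ∎
      where
      g = fromℚ (- (a⁻¹ * v i y))
      lemma : ∀ p q r s → p * (q - r * s) ≡ p * q + p * r * (- s)
      lemma = solve 4 (λ p q r s → p :* (q :- r :* s) := p :* q :+ p :* r :* (:- s)) refl
        where open +-*-Solver

    eliminate : ∀ d t y →
      lin w d y ≈ᴿ total d t y +ᴿ total d t x *ᴿ fromℚ (- (a⁻¹ * v i y))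
    eliminate d t y = ≈trans (lin-w d y)
      (pointwise⇒≈
        (λ n → lemma (seq (lin u d y) n) (seq (lin u d x) n) (seq t n) (v i y)))
      where
      lemma : ∀ p q t b → p + q * (- (a⁻¹ * b)) ≡ (t * b + p) + (t * a + q) * (- (a⁻¹ * b))
      lemma p q t b = sym (trans
        (solve 6 (λ p q t b a e →
            (t :* b :+ p) :+ (t :* a :+ q) :* (:- (e :* b)) :=
            (p :+ q :* (:- (e :* b))) :+ (t :* b) :* (con 1ℚ :- a :* e))
          refl p q t b a a⁻¹)
        (trans (cong (λ z → (p + q * (- (a⁻¹ * b))) + (t * b) * (1ℚ - z)) a*a⁻¹≡1)
          (trans (cong (λ z → p + q * (- (a⁻¹ * b)) + z) (*-zeroʳ (t * b)))
            (+-identityʳ (p + q * (- (a⁻¹ * b)))))))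
        where open +-*-Solver

    lin-w≈0 : ∀ d t {y} → total d t x ≈ᴿ 0ᴿ → total d t y ≈ᴿ 0ᴿ → lin w d y ≈ᴿ 0ᴿ
    lin-w≈0 d t {y} ex ey = begin
      lin w d y                       ≈⟨ eliminate d t y ⟩
      total d t y +ᴿ total d t x *ᴿ g ≈⟨ +-cong
                                           ey (*-congʳ ex) ⟩
      0ᴿ +ᴿ 0ᴿ *ᴿ g                   ≈⟨ ℝ-ring.+-identityˡ (0ᴿ *ᴿ g) ⟩
      0ᴿ *ᴿ g                         ≈⟨ ℝ-ring.zeroˡ g ⟩
      0ᴿ ∎
      where g = fromℚ (- (a⁻¹ * v i y))

    total≈0 : ∀ d t {y} → total d t x ≈ᴿ 0ᴿ → lin w d y ≈ᴿ 0ᴿ → total d t y ≈ᴿ 0ᴿ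
    total≈0 d t {y} ex ew = begin
      total d t y                     ≈⟨ ℝ-ring.+-identityʳ (total d t y) ⟨
      total d t y +ᴿ 0ᴿ               ≈⟨ +-congˡ (ℝ-ring.zeroˡ g) ⟨
      total d t y +ᴿ 0ᴿ *ᴿ g          ≈⟨ +-congˡ
                                           (*-congʳ ex) ⟨
      total d t y +ᴿ total d t x *ᴿ g ≈⟨ eliminate d t y ⟨
      lin w d y                       ≈⟨ ew ⟩
      0ᴿ ∎
      where g = fromℚ (- (a⁻¹ * v i y))

    lin≈0 : ∀ (b : Fin k → X → ℚ) d → (∀ j → d j ≈ᴿ 0ᴿ) → ∀ y → lin b d y ≈ᴿ 0ᴿ
    lin≈0 b d d≈0 y = begin
      lin b d y
        ≈⟨ sum-cong-≋ (λ j → *-congʳ (d≈0 j)) ⟩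
      sum (λ j → 0ᴿ *ᴿ fromℚ (b j y))
        ≈⟨ sum-cong-≋ (λ j → ℝ-ring.zeroˡ (fromℚ (b j y))) ⟩
      sum {k} (λ _ → 0ᴿ)
        ≈⟨ sum-replicate-zero k ⟩
      0ᴿ ∎

    coefficient≈0 : ∀ t → t *ᴿ fromℚ a ≈ᴿ 0ᴿ → t ≈ᴿ 0ᴿ
    coefficient≈0 t e = begin
      t                             ≈⟨ pointwise⇒≈ (λ n → eq (seq t n)) ⟩
      t *ᴿ fromℚ a *ᴿ fromℚ a⁻¹     ≈⟨ *-congʳ e ⟩
      0ᴿ *ᴿ fromℚ a⁻¹               ≈⟨ ℝ-ring.zeroˡ (fromℚ a⁻¹) ⟩
      0ᴿ ∎
      where
      eq : ∀ s → s ≡ s * a * a⁻¹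
      eq s = sym (trans (*-assoc s a a⁻¹)
        (trans (cong (s *_) a*a⁻¹≡1) (*-identityʳ s)))

    from : ∀ {xs} → IndependentOn xs w → IndependentOn (x ∷ xs) v
    from {xs} W c eqs = c≈0
      where
      d = removeAt c i
      ev : ∀ {y} → y ∈ x ∷ xs → total d (c i) y ≈ᴿ 0ᴿ
      ev {y} y∈ = ≈trans
        (≈sym (lin-total c y)) (eqs y∈)
      d≈0 : ∀ j → d j ≈ᴿ 0ᴿ
      d≈0 = W d (λ y∈ → lin-w≈0 d (c i) (ev (here refl)) (ev (there y∈)))
      ci≈0 : c i ≈ᴿ 0ᴿ
      ci≈0 = coefficient≈0 (c i) (begin
        c i *ᴿ fromℚ a          ≈⟨ ℝ-ring.+-identityʳ (c i *ᴿ fromℚ a) ⟨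
        c i *ᴿ fromℚ a +ᴿ 0ᴿ    ≈⟨ +-congˡ (lin≈0 u d d≈0 x) ⟨
        total d (c i) x         ≈⟨ ev (here refl) ⟩
        0ᴿ ∎)
      c≈0 : ∀ j → c j ≈ᴿ 0ᴿ
      c≈0 j with i Fin.≟ j
      ... | yes refl = ci≈0
      ... | no  i≢j  = subst (λ l → c l ≈ᴿ 0ᴿ) (punchIn-punchOut i≢j) (d≈0 (punchOut i≢j))

    to : ∀ {xs} → IndependentOn (x ∷ xs) v → IndependentOn xs w
    to {xs} V d eqs j =
      subst (_≈ᴿ 0ᴿ) (insertAt-punchIn d i t j) (V c ev (punchIn i j))
      where
      t : ℝ
      t = lin u d x *ᴿ fromℚ (- a⁻¹)
      c : Fin (suc k) → ℝ
      c = insertAt d i t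
      total-c : ∀ y → lin v c y ≈ᴿ total d t y
      total-c y = ≈trans (lin-total c y)
        (+-cong
          (≈reflexive (cong (_*ᴿ fromℚ (v i y)) (insertAt-lookup d i t)))
          (sum-cong-≋ (λ l → ≈reflexive
            (cong (_*ᴿ fromℚ (u l y)) (insertAt-punchIn d i t l)))))
      ex : total d t x ≈ᴿ 0ᴿ
      ex = pointwise⇒≈ (λ n → eq (seq (lin u d x) n))
        where
        eq : ∀ s → s * - a⁻¹ * a + s ≡ 0ℚ
        eq s = trans
          (solve 3 (λ s a e → s :* (:- e) :* a :+ s := s :* (con 1ℚ :- a :* e)) refl s a a⁻¹)
          (trans (cong (λ z → s * (1ℚ - z)) a*a⁻¹≡1) (*-zeroʳ s))
          where open +-*-Solver
      ev : ∀ {y} → y ∈ x ∷ xs → lin v c y ≈ᴿ 0ᴿ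
      ev {y} (here refl) = ≈trans (total-c y) ex
      ev {y} (there y∈)  = ≈trans (total-c y)
        (total≈0 d t ex (eqs y∈))

  lin-zero : ∀ {k} (v : Fin k → X → ℚ) c x → (∀ i → v i x ≡ 0ℚ) → lin v c x ≈ᴿ 0ᴿ
  lin-zero {k} v c x v≡0 = begin
    lin v c x            ≈⟨ sum-cong-≋ (λ i → pointwise⇒≈ (λ n →
                              trans (cong (seq (c i) n *_) (v≡0 i)) (*-zeroʳ (seq (c i) n)))) ⟩
    sum {k} (λ _ → 0ᴿ)   ≈⟨ sum-replicate-zero k ⟩
    0ᴿ ∎

  independentOn? : ∀ {k} xs (v : Fin k → X → ℚ) → Dec (IndependentOn xs v)
  independentOn? {zero}  xs v = yes (λ _ _ ())
  independentOn? {suc k} [] v = no (λ I → 1≉0 (I (λ _ → 1ᴿ) (λ ()) zero))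
  independentOn? {suc k} (x ∷ xs) v with any? (λ i → ¬? (v i x ≟ 0ℚ))
  ... | yes (i , vix≢0) = map′ from to (independentOn? xs w)
    where
    instance
      vix-nonZero : NonZero (v i x)
      vix-nonZero = ≢-nonZero vix≢0
    open Pivot v x i (1/ v i x) (*-inverseʳ (v i x))
  ... | no ¬pivot = map′ extend restrict (independentOn? xs v)
    where
    v≡0 : ∀ i → v i x ≡ 0ℚ
    v≡0 i = decidable-stable (v i x ≟ 0ℚ) (λ vix≢0 → ¬pivot (i , vix≢0))
    extend : IndependentOn xs v → IndependentOn (x ∷ xs) v
    extend I c eqs = I c (λ y∈ → eqs (there y∈))
    restrict : IndependentOn (x ∷ xs) v → IndependentOn xs v
    restrict I c eqs = I c eqs′
      where
      eqs′ : ∀ {y} → y ∈ x ∷ xs → lin v c y ≈ᴿ 0ᴿ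
      eqs′ (here refl) = lin-zero v c x v≡0
      eqs′ (there y∈)  = eqs y∈

sublists : ∀ {A : Set} → List A → List (List A)
sublists []       = [] ∷ []
sublists (x ∷ xs) = map (x ∷_) (sublists xs) ++ sublists xs

Cube : ℕ → Set
Cube n = Vec Bool n

cube : ∀ n → List (Cube n)
cube zero    = Vec.[] ∷ []
cube (suc n) = map (false Vec.∷_) (cube n) ++ map (true Vec.∷_) (cube n)

∈-cube : ∀ {n} (x : Cube n) → x ∈ cube n
∈-cube Vec.[]          = here refl
∈-cube (false Vec.∷ x) = ∈-++⁺ˡ (∈-map⁺ (false Vec.∷_) (∈-cube x))
∈-cube {suc n} (true Vec.∷ x) =
  ∈-++⁺ʳ (map (false Vec.∷_) (cube n)) (∈-map⁺ (true Vec.∷_) (∈-cube x))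

columns : ∀ {n} → (Cube n → Cube n → ℚ) → (ys : List (Cube n)) →
          Fin (length ys) → Cube n → ℝ
columns M ys i x = fromℚ (M x (lookup ys i))

independent? : ∀ {n} (M : Cube n → Cube n → ℚ) →
               Decidable (λ ys → LinearlyIndependent (columns M ys))
independent? {n} M ys = map′
  (λ I c eqs → I c (λ {x} _ → eqs x))
  (λ I c eqs → I c (λ x → eqs (∈-cube x)))
  (Elimination.independentOn? (cube n) (λ i x → M x (lookup ys i)))

-- Only the entries are rational: `independent?` tests independence of the
-- columns with real coefficients, so this is the column rank over ℝ.
rank : ∀ {n} → (Cube n → Cube n → ℚ) → ℕ
rank {n} M = max 0 (map length (filter (independent? M) (sublists (cube n))))

infixl 6 _⊕_

_⊕_ : ∀ {n} → Cube n → Cube n → Cube n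
_⊕_ = zipWith _xor_

BooleanFunction : ℕ → Set
BooleanFunction n = Cube n → Bool

-- Subset n is Vec Bool n, so a block B ⊆ [n] is its own characteristic
-- vector e_B, and ⁅ i ⁆ is e_i.
Sensitive : ∀ {n} → BooleanFunction n → Cube n → Subset n → Set
Sensitive f x B = f (x ⊕ B) ≢ f x

sensitive? : ∀ {n} (f : BooleanFunction n) x → Decidable (Sensitive f x)
sensitive? f x B = ¬? (f (x ⊕ B) Bool.≟ f x)

sensitivityAt : ∀ {n} → BooleanFunction n → Cube n → ℕ
sensitivityAt {n} f x = length (filter (λ i → sensitive? f x ⁅ i ⁆) (allFin n))

sensitivity : ∀ {n} → BooleanFunction n → ℕ
sensitivity {n} f = max 0 (map (sensitivityAt f) (cube n))

Disjoint : ∀ {n} → Subset n → Subset n → Set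
Disjoint B C = Empty (B ∩ C)

DisjointSensitive : ∀ {n} → BooleanFunction n → Cube n → List (Subset n) → Set
DisjointSensitive f x Bs = All (Sensitive f x) Bs × AllPairs Disjoint Bs

disjointSensitive? : ∀ {n} (f : BooleanFunction n) x → Decidable (DisjointSensitive f x)
disjointSensitive? f x Bs =
  All.all? (sensitive? f x) Bs ×-dec AllPairs.allPairs? (λ B C → ¬? (nonempty? (B ∩ C))) Bs

-- Sensitive blocks are nonempty, so pairwise disjoint ones are distinct and
-- it suffices to search the sublists of the list of all subsets.
blockSensitivityAt : ∀ {n} → BooleanFunction n → Cube n → ℕ
blockSensitivityAt {n} f x =
  max 0 (map length (filter (disjointSensitive? f x) (sublists (cube n))))

blockSensitivity : ∀ {n} → BooleanFunction n → ℕ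
blockSensitivity {n} f = max 0 (map (blockSensitivityAt f) (cube n))

toℚ : Bool → ℚ
toℚ false = 0ℚ
toℚ true  = 1ℚ

xorMatrix : ∀ {n} → BooleanFunction n → Cube n → Cube n → ℚ
xorMatrix f x y = toℚ (f (x ⊕ y))

module Submission where

-- (1) ⇒ (2): a maximal family of disjoint minimal sensitive blocks at x consists of at most bs(f)
-- blocks of size at most s(f), and its union is a certificate. Certificates of size C yield a
-- decision tree of depth C², and a decision tree of depth D writes every row of f(x ⊕ y) in terms
-- of at most 4ᴰ functions of y.
--
-- (2) ⇒ (1): replacing every variable by a conjunction of two variables at most doubles the
-- sensitivity, and makes the rank at least 2ᵈ for every d such that f(x ⊕ z) has a monomial of
-- degree d in z. Hence (2) bounds the degree by a polynomial in s(f). Toggling each of k disjoint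
-- sensitive blocks with probability t gives a polynomial in t of the same degree with values in
-- [0,1] on [0,1] and with derivative ±k at 0, so that k is polynomially bounded in the degree.

open import Defs
open import Data.Bool.Base using (Bool; true; false; not; _∧_; _xor_; if_then_else_)
import Data.Bool.Properties as Bool
open import Data.Empty using (⊥; ⊥-elim)
open import Data.Fin.Base using (Fin; zero; suc; _↑ˡ_; _↑ʳ_; punchIn; splitAt)
open import Data.Fin.Properties as Fin using (punchInᵢ≢i; splitAt⁻¹-↑ˡ; splitAt⁻¹-↑ʳ)
open import Data.Fin.Subset using (Subset; ⁅_⁆; _∩_; ∁) renaming (∣_∣ to ∥_∥)
open import Data.Fin.Subset.Properties
  using (x∈⁅x⁆; x∈⁅y⁆⇒x≡y; x∈p∩q⁺; x∈p∩q⁻; x∉p⇒x∈∁p; x∈∁p⇒x∉p; ∩-comm; nonempty?;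
         p∩q⊆p; p⊆q⇒∣p∣≤∣q∣; p⊂q⇒∣p∣<∣q∣)
import Data.Integer.Base as ℤ
import Data.Integer.Properties as ℤ
open import Data.List.Base as List using (List; []; _∷_; _++_; map; filter; length; allFin; concatMap)
open import Data.List.Extrema.Nat using (max; max≤v⁺; xs≤max)
open import Data.List.Membership.Propositional using (_∈_; find)
open import Data.List.Membership.Propositional.Properties
  using (∈-map⁺; ∈-map⁻; ∈-++⁺ˡ; ∈-++⁺ʳ; ∈-++⁻; ∈-filter⁺; ∈-filter⁻; ∈-∃++; ∈-allFin; ∈-lookup;
         ∈-concatMap⁺)
import Data.List.Membership.DecPropositional as DecMembership
open import Data.List.Properties using (length-++; length-map; length-filter; filter-some)
open import Data.List.Relation.Binary.Permutation.Propositional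
  using (_↭_; ↭-refl; ↭-sym; ↭-trans; ↭-prep; ↭⇒↭ₛ)
open import Data.List.Relation.Binary.Permutation.Propositional.Properties
  using (shift; ∈-resp-↭; All-resp-↭; ↭-length)
import Data.List.Relation.Binary.Permutation.Setoid.Properties as Permutation
open import Data.List.Relation.Unary.All as All using (All; []; _∷_)
open import Data.List.Relation.Unary.AllPairs using (AllPairs; []; _∷_)
open import Data.List.Relation.Unary.Any as Any using (here; there)
open import Data.List.Relation.Unary.Unique.Propositional using (Unique)
import Data.List.Relation.Unary.Unique.Propositional.Properties as Unique
open import Data.Nat.Base
  using (ℕ; zero; suc; pred; _+_; _*_; _∸_; _^_; _!; _≤_; _<_; _≥_; z≤n; s≤s; NonZero; >-nonZero)
open import Data.Nat.Combinatorics using (nCk≡n!/k![n-k]!; nCk+nC[k+1]≡[n+1]C[k+1]; k![n∸k]!∣n!)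
  renaming (_C_ to _choose_)
import Data.Nat.DivMod as ℕ
open import Data.Nat.Logarithm using (⌊log₂_⌋; ⌊log₂⌋-mono-≤; ⌊log₂[2^n]⌋≡n)
import Data.Nat.Properties as ℕ
open import Data.Nat.Properties using (_!≢0; _!*_!≢0)
open import Data.Nat.Tactic.RingSolver using (solve-∀)
open import Data.Product.Base using (_×_; _,_; proj₁; proj₂; ∃-syntax)
open import Data.Rational.Base using (ℚ; mkℚ; *<*; 0ℚ; 1ℚ; ½; 1/_; _/_; ∣_∣)
  renaming (_+_ to _+ℚ_; _*_ to _*ℚ_; _-_ to _-ℚ_; -_ to -ℚ_; _≤_ to _≤ℚ_; _<_ to _<ℚ_)
import Data.Rational.Base as ℚ
import Data.Rational.Properties as ℚ
open import Data.Rational.Solver using (module +-*-Solver)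
import Data.Rational.Unnormalised.Base as ℚᵘ
import Data.Rational.Unnormalised.Properties as ℚᵘ
open import Data.Sum.Base using (inj₁; inj₂)
open import Data.Unit.Base using (⊤; tt)
open import Data.Vec.Base as Vec using (Vec; []; _∷_; lookup; tabulate; replicate; head; tail; _[_]≔_)
open import Data.Vec.Properties as Vec
  using (lookup-zipWith; lookup⇒[]=; []=⇒lookup; lookup∘tabulate; tabulate∘lookup; tabulate-cong;
         lookup∘update; lookup∘update′; lookup-replicate; zipWith-++; take++drop≡id)
open import Function.Base using (_∘_; id)
open import Function.Bundles using (_⇔_; mk⇔)
open import Relation.Binary.Definitions using (DecidableEquality)
import Relation.Binary.Construct.Add.Infimum.NonStrict as NonStrict
open import Relation.Binary.PropositionalEquality
  using (_≡_; _≢_; refl; sym; trans; cong; cong₂; subst; subst₂; setoid; resp₂; module ≡-Reasoning)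
open import Relation.Nullary.Construct.Add.Infimum using ([_])
open import Relation.Nullary.Decidable using (Dec; yes; no; ¬?; decidable-stable; _×-dec_; map′)
open import Relation.Nullary.Negation using (¬_; contradiction)
open import Relation.Unary using (Decidable)

open ℝ-sum using (sum; sum-cong-≋; ∑-distrib-+; sum-remove; *-distribʳ-sum; sum-replicate-zero)

-- The conjunctions are what lets rank control degree: parity on n ≥ 1 variables has degree n
-- although its matrix has rank 2, so the rank of f(x ⊕ y) by itself bounds no degree. Shifting by x
-- before substituting moves the point with many sensitive blocks to the origin, where the blocks
-- act as plain sets. Interpolation takes the place of Markov's inequality and stays inside ℚ.
-- Extrapolating to 0 from equally spaced nodes j/k would cost a factor exponential in k; the nodes
-- (j/k)² crowd towards 0 and cost only a polynomial one. The resulting bound is cubic in the degree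
-- instead of quadratic, which is still a polynomial. `rank` speaks of independent columns. Both
-- rank estimates treat rows as functionals on combinations of columns, so the equality of row rank
-- and column rank is never invoked. Real numbers enter only through the given polynomial and the
-- logarithm: a real polynomial is dominated on ℕ by one with natural coefficients, and all further
-- bounds are between natural numbers.

private
  variable
    A : Set
    n : ℕ

-- Sensitive blocks and certificates

∈⇒≤max : ∀ {m ms} → m ∈ ms → m ≤ max 0 ms
∈⇒≤max {ms = ms} m∈ = All.lookup (xs≤max 0 ms) m∈

max≤ : ∀ {v ms} → (∀ {m} → m ∈ ms → m ≤ v) → max 0 ms ≤ v
max≤ h = max≤v⁺ z≤n (All.tabulate h)

module _ {P Q : A → Set} (P? : Decidable P) (Q? : Decidable Q) (P⊆Q : ∀ {x} → P x → Q x) where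

  length-filter-≤ : ∀ xs → length (filter P? xs) ≤ length (filter Q? xs)
  length-filter-≤ [] = z≤n
  length-filter-≤ (x ∷ xs) with P? x | Q? x
  ... | yes _ | yes _ = s≤s (length-filter-≤ xs)
  ... | yes p | no ¬q = contradiction (P⊆Q p) ¬q
  ... | no _  | yes _ = ℕ.m≤n⇒m≤1+n (length-filter-≤ xs)
  ... | no _  | no _  = length-filter-≤ xs

  length-filter-< : ∀ {x xs} → x ∈ xs → Q x → ¬ P x →
                    length (filter P? xs) < length (filter Q? xs)
  length-filter-< {x} {_ ∷ xs} (here refl) q ¬p with P? x | Q? x
  ... | yes p | _     = contradiction p ¬p
  ... | no _  | no ¬q = contradiction q ¬q
  ... | no _  | yes _ = s≤s (length-filter-≤ xs)
  length-filter-< {x} {y ∷ xs} (there x∈) q ¬p with P? y | Q? y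
  ... | yes _ | yes _ = s≤s (length-filter-< x∈ q ¬p)
  ... | yes p | no ¬q = contradiction (P⊆Q p) ¬q
  ... | no _  | yes _ = ℕ.m≤n⇒m≤1+n (length-filter-< x∈ q ¬p)
  ... | no _  | no _  = length-filter-< x∈ q ¬p

Unique-resp-↭ : ∀ {xs ys : List A} → xs ↭ ys → Unique xs → Unique ys
Unique-resp-↭ xs↭ys = Permutation.Unique-resp-↭ (setoid _) (↭⇒↭ₛ xs↭ys)

module _ (_≟_ : DecidableEquality A) where
  open DecMembership _≟_ using (_∈?_)

  -- `rank` and `blockSensitivity` maximise over `sublists (cube n)`, which keep the order of the
  -- enumeration; a duplicate-free family in any order has to be rearranged before it counts.
  unique⇒↭sublist : ∀ {xs ys} → Unique ys → (∀ {y} → y ∈ ys → y ∈ xs) →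
                    ∃[ zs ] zs ∈ sublists xs × ys ↭ zs
  unique⇒↭sublist {[]} {[]} _ _ = [] , here refl , ↭-refl
  unique⇒↭sublist {[]} {_ ∷ _} _ ys⊆[] with () ← ys⊆[] (here refl)
  unique⇒↭sublist {x ∷ xs} {ys} ys! ys⊆ with x ∈? ys
  ... | no x∉ys =
    let zs , zs∈ , ys↭zs = unique⇒↭sublist {xs} ys! drop-x
    in zs , ∈-++⁺ʳ (map (x ∷_) (sublists xs)) zs∈ , ys↭zs
    where
    drop-x : ∀ {y} → y ∈ ys → y ∈ xs
    drop-x y∈ with ys⊆ y∈
    ... | here refl = contradiction y∈ x∉ys
    ... | there y∈xs = y∈xs
  ... | yes x∈ys with ∈-∃++ x∈ys
  ...   | as , bs , refl with Unique-resp-↭ (shift x as bs) ys!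
  ...     | x∉ ∷ rest! =
    let zs , zs∈ , rest↭zs = unique⇒↭sublist {xs} rest! drop-x
    in x ∷ zs , ∈-++⁺ˡ (∈-map⁺ (x ∷_) zs∈) , ↭-trans (shift x as bs) (↭-prep x rest↭zs)
    where
    drop-x : ∀ {y} → y ∈ as ++ bs → y ∈ xs
    drop-x y∈ with ys⊆ (∈-resp-↭ (↭-sym (shift x as bs)) (there y∈))
    ... | here refl = contradiction refl (All.lookup x∉ y∈)
    ... | there y∈xs = y∈xs

  unique-⊆⇒length-≤ : ∀ {xs ys} → Unique ys → (∀ {y} → y ∈ ys → y ∈ xs) → length ys ≤ length xs
  unique-⊆⇒length-≤ {xs} ys! ys⊆ =
    let zs , zs∈ , ys↭zs = unique⇒↭sublist ys! ys⊆
    in subst (_≤ length xs) (sym (↭-length ys↭zs)) (sublists-length xs zs∈)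
    where
    sublists-length : ∀ xs {zs : List A} → zs ∈ sublists xs → length zs ≤ length xs
    sublists-length [] (here refl) = z≤n
    sublists-length (x ∷ xs) zs∈ with ∈-++⁻ (map (x ∷_) (sublists xs)) zs∈
    ... | inj₂ zs∈′ = ℕ.m≤n⇒m≤1+n (sublists-length xs zs∈′)
    ... | inj₁ zs∈′ with ∈-map⁻ (x ∷_) zs∈′
    ...   | _ , ws∈ , refl = s≤s (sublists-length xs ws∈)

-- Points of the cube and disjoint blocks

infix 4 _≟ᶜ_

_≟ᶜ_ : DecidableEquality (Cube n)
_≟ᶜ_ = Vec.≡-dec Bool._≟_

lookup-ext : ∀ {u v : Vec A n} → (∀ i → lookup u i ≡ lookup v i) → u ≡ v
lookup-ext {u = u} {v} u≗v =
  trans (sym (tabulate∘lookup u)) (trans (tabulate-cong u≗v) (tabulate∘lookup v))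

lookup-⊕ : ∀ (x y : Cube n) i → lookup (x ⊕ y) i ≡ lookup x i xor lookup y i
lookup-⊕ x y i = lookup-zipWith _xor_ i x y

⊕-assoc : ∀ (x y z : Cube n) → x ⊕ y ⊕ z ≡ x ⊕ (y ⊕ z)
⊕-assoc = Vec.zipWith-assoc Bool.xor-assoc

⊕-cancel : ∀ (x y : Cube n) → x ⊕ (x ⊕ y) ≡ y
⊕-cancel [] [] = refl
⊕-cancel (false ∷ x) (b ∷ y) = cong (b ∷_) (⊕-cancel x y)
⊕-cancel (true ∷ x) (b ∷ y) = cong₂ _∷_ (Bool.not-involutive b) (⊕-cancel x y)

lookup-⁅⁆ : ∀ (i : Fin n) → lookup ⁅ i ⁆ i ≡ true
lookup-⁅⁆ i = []=⇒lookup (x∈⁅x⁆ i)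

lookup-⁅⁆⇒≡ : ∀ {i j : Fin n} → lookup ⁅ i ⁆ j ≡ true → j ≡ i
lookup-⁅⁆⇒≡ {i = i} {j} p = x∈⁅y⁆⇒x≡y i (lookup⇒[]= j ⁅ i ⁆ p)

disjoint⁺ : ∀ {B C : Subset n} → (∀ i → lookup B i ≡ true → lookup C i ≡ true → ⊥) → Disjoint B C
disjoint⁺ h (i , i∈) = let i∈B , i∈C = x∈p∩q⁻ _ _ i∈ in h i ([]=⇒lookup i∈B) ([]=⇒lookup i∈C)

disjoint⁻ : ∀ {B C : Subset n} → Disjoint B C → ∀ i → lookup B i ≡ true → lookup C i ≡ true → ⊥
disjoint⁻ {B = B} {C} d i p q = d (i , x∈p∩q⁺ (lookup⇒[]= i B p , lookup⇒[]= i C q))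

Disjoint-sym : ∀ {B C : Subset n} → Disjoint B C → Disjoint C B
Disjoint-sym d = disjoint⁺ (λ i p q → disjoint⁻ d i q p)

-- A block disjoint from itself is empty, and toggling it changes nothing. Pairwise disjoint
-- sensitive blocks are therefore distinct.
sensitive⇒¬selfdisjoint : ∀ {f : BooleanFunction n} {x B} → Sensitive f x B → ¬ Disjoint B B
sensitive⇒¬selfdisjoint {f = f} {x} {B} s d = s (cong f (lookup-ext same))
  where
  same : ∀ i → lookup (x ⊕ B) i ≡ lookup x i
  same i rewrite lookup-⊕ x B i with lookup B i in eq
  ... | false = Bool.xor-identityʳ (lookup x i)
  ... | true  = ⊥-elim (disjoint⁻ d i eq eq)

disjointSensitive-unique : ∀ {f : BooleanFunction n} {x Bs} → DisjointSensitive f x Bs → Unique Bs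
disjointSensitive-unique ([] , []) = []
disjointSensitive-unique {f = f} {x} (s ∷ ss , d ∷ ds) =
  All.map (λ dBC → λ { refl → sensitive⇒¬selfdisjoint {f = f} {x} s dBC }) d ∷
  disjointSensitive-unique {f = f} {x} (ss , ds)

length≤blockSensitivity : ∀ (f : BooleanFunction n) {x Bs} → DisjointSensitive f x Bs →
                          length Bs ≤ blockSensitivity f
length≤blockSensitivity {n} f {x} {Bs} ds@(ss , dd)
  with unique⇒↭sublist _≟ᶜ_ (disjointSensitive-unique {f = f} {x} ds) (λ {B} _ → ∈-cube B)
... | Cs , Cs∈ , Bs↭Cs = begin
  length Bs              ≡⟨ ↭-length Bs↭Cs ⟩
  length Cs              ≤⟨ ∈⇒≤max (∈-map⁺ length (∈-filter⁺ (disjointSensitive? f x) Cs∈ ds′)) ⟩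
  blockSensitivityAt f x ≤⟨ ∈⇒≤max (∈-map⁺ (blockSensitivityAt f) (∈-cube x)) ⟩
  blockSensitivity f     ∎
  where
  open ℕ.≤-Reasoning
  ds′ : DisjointSensitive f x Cs
  ds′ = All-resp-↭ Bs↭Cs ss
      , Permutation.AllPairs-resp-↭ (setoid _) Disjoint-sym (resp₂ Disjoint) (↭⇒↭ₛ Bs↭Cs) dd

blockSensitivity≤ : ∀ (f : BooleanFunction n) {v} →
                    (∀ x Bs → DisjointSensitive f x Bs → length Bs ≤ v) → blockSensitivity f ≤ v
blockSensitivity≤ {n} f h = max≤ outer
  where
  outer : ∀ {m} → m ∈ map (blockSensitivityAt f) (cube n) → m ≤ _
  outer m∈ with ∈-map⁻ (blockSensitivityAt f) m∈
  ... | x , _ , refl = max≤ inner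
    where
    inner : ∀ {m} → m ∈ map length (filter (disjointSensitive? f x) (sublists (cube n))) → m ≤ _
    inner m∈ with ∈-map⁻ length m∈
    ... | Bs , Bs∈ , refl = h x Bs (proj₂ (∈-filter⁻ (disjointSensitive? f x) {xs = sublists (cube n)} Bs∈))

sensitivityAt≤sensitivity : ∀ (f : BooleanFunction n) x → sensitivityAt f x ≤ sensitivity f
sensitivityAt≤sensitivity f x = ∈⇒≤max (∈-map⁺ (sensitivityAt f) (∈-cube x))

elements : Subset n → List (Fin n)
elements {n} B = filter (λ i → lookup B i Bool.≟ true) (allFin n)

∈-elements⁺ : ∀ (B : Subset n) {i} → lookup B i ≡ true → i ∈ elements B
∈-elements⁺ B {i} = ∈-filter⁺ (λ i → lookup B i Bool.≟ true) (∈-allFin i)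

infix 4 _⊆ᵇ_

_⊆ᵇ_ : Subset n → Subset n → Set
B ⊆ᵇ C = ∀ i → lookup B i ≡ true → lookup C i ≡ true

toggle-⊆ : ∀ (B : Subset n) {i} → lookup B i ≡ true → B ⊕ ⁅ i ⁆ ⊆ᵇ B
toggle-⊆ B {i} i∈B j p rewrite lookup-⊕ B ⁅ i ⁆ j with lookup ⁅ i ⁆ j in eq
... | true  = trans (cong (lookup B) (lookup-⁅⁆⇒≡ eq)) i∈B
... | false = trans (sym (Bool.xor-identityʳ (lookup B j))) p

toggle-removes : ∀ (B : Subset n) {i} → lookup B i ≡ true → lookup (B ⊕ ⁅ i ⁆) i ≢ true
toggle-removes B {i} i∈B p rewrite lookup-⊕ B ⁅ i ⁆ i | i∈B | lookup-⁅⁆ i with () ← p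

module _ (f : BooleanFunction n) (x : Cube n) where

  -- In a minimal block B every coordinate is sensitive at x ⊕ B, so |B| ≤ s(f).
  minimal-block-size : ∀ {B} → Sensitive f x B →
    (∀ i → lookup B i ≡ true → ¬ Sensitive f x (B ⊕ ⁅ i ⁆)) →
    length (elements B) ≤ sensitivity f
  minimal-block-size {B} sB minimal = ℕ.≤-trans
    (length-filter-≤ (λ i → lookup B i Bool.≟ true) (λ i → sensitive? f (x ⊕ B) ⁅ i ⁆) sens (allFin n))
    (sensitivityAt≤sensitivity f (x ⊕ B))
    where
    sens : ∀ {i} → lookup B i ≡ true → Sensitive f (x ⊕ B) ⁅ i ⁆
    sens {i} i∈B eq = minimal i i∈B λ eq′ → sB (trans (sym eq) (trans (cong f (⊕-assoc x B ⁅ i ⁆)) eq′))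

  -- Coordinates are dropped while the block stays sensitive; `m` bounds its shrinking size, so the
  -- search ends.
  minimal-block : ∀ m B → length (elements B) < m → Sensitive f x B →
    ∃[ C ] Sensitive f x C × C ⊆ᵇ B × length (elements C) ≤ sensitivity f
  minimal-block (suc m) B (s≤s B≤m) sB
    with Fin.any? (λ i → (lookup B i Bool.≟ true) ×-dec sensitive? f x (B ⊕ ⁅ i ⁆))
  ... | no ∄i = B , sB , (λ _ p → p) , minimal-block-size sB (λ i p q → ∄i (i , p , q))
  ... | yes (i , i∈B , s′) =
    let C , sC , C⊆ , small = minimal-block m (B ⊕ ⁅ i ⁆) (ℕ.<-≤-trans smaller B≤m) s′
    in C , sC , (λ j p → toggle-⊆ B i∈B j (C⊆ j p)) , small
    where
    smaller : length (elements (B ⊕ ⁅ i ⁆)) < length (elements B)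
    smaller = length-filter-< (λ j → lookup (B ⊕ ⁅ i ⁆) j Bool.≟ true) (λ j → lookup B j Bool.≟ true)
      (λ {j} → toggle-⊆ B i∈B j) (∈-allFin i) i∈B (toggle-removes B i∈B)

AgreeOn : List (Fin n) → Cube n → Cube n → Set
AgreeOn S x y = ∀ {i} → i ∈ S → lookup y i ≡ lookup x i

Certificate : BooleanFunction n → Cube n → List (Fin n) → Set
Certificate f x S = ∀ y → AgreeOn S x y → f y ≡ f x

-- The union of a maximal family of disjoint minimal sensitive blocks is a certificate.
module _ (f : BooleanFunction n) (x : Cube n) where

  private
    Small : Subset n → Set
    Small B = length (elements B) ≤ sensitivity f

  length-concatMap-elements : ∀ {Bs} → All Small Bs →
    length (concatMap elements Bs) ≤ length Bs * sensitivity f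
  length-concatMap-elements [] = z≤n
  length-concatMap-elements {B ∷ Bs} (b ∷ bs) = subst (_≤ _)
    (sym (length-++ (elements B))) (ℕ.+-mono-≤ b (length-concatMap-elements bs))

  -- Greedy extension: `m` further blocks would push the family past bs(f), so it stops before `m`
  -- runs out.
  maximal-blocks : ∀ m Bs → blockSensitivity f < m + length Bs →
    DisjointSensitive f x Bs → All Small Bs →
    ∃[ Cs ] DisjointSensitive f x Cs × All Small Cs ×
            (∀ B → Sensitive f x B → ¬ All (Disjoint B) Cs)
  maximal-blocks zero Bs big ds small =
    contradiction (length≤blockSensitivity f {x} ds) (ℕ.<⇒≱ big)
  maximal-blocks (suc m) Bs big ds@(ss , dd) small
    with Any.any? (λ B → sensitive? f x B ×-dec All.all? (λ C → ¬? (nonempty? (B ∩ C))) Bs) (cube n)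
  ... | no ∄B = Bs , ds , small , λ B s d → ∄B (Any.map (λ { refl → s , d }) (∈-cube B))
  ... | yes ∃B with find ∃B
  ...   | B , _ , s , d =
    -- A minimal block inside `B` stays disjoint from the family and is small.
    let C , sC , C⊆B , smallC = minimal-block f x _ B (ℕ.n<1+n _) s in
    maximal-blocks m (C ∷ Bs)
      (subst (blockSensitivity f <_) (sym (ℕ.+-suc m (length Bs))) big)
      (sC ∷ ss , All.map (λ dBD → disjoint⁺ (λ i p q → disjoint⁻ dBD i (C⊆B i p) q)) d ∷ dd)
      (smallC ∷ small)

  small-certificate : ∃[ S ] Certificate f x S × length S ≤ blockSensitivity f * sensitivity f
  small-certificate =
    let Cs , ds , small , maximal = maximal-blocks (suc (blockSensitivity f)) []
                                      (ℕ.m≤m+n _ 0) ([] , []) []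
    in concatMap elements Cs
     , (λ y agree → decidable-stable (f y Bool.≟ f x) λ fy≢fx →
          -- The coordinates where `y` differs from `x` would form a sensitive block avoiding the
          -- union, and could have extended the family.
          maximal (x ⊕ y) (λ eq → fy≢fx (trans (sym (cong f (⊕-cancel x y))) eq))
            (All.tabulate λ {C} C∈ → disjoint⁺ λ i p q → differ agree C∈ i p q))
     , ℕ.≤-trans (length-concatMap-elements small)
         (ℕ.*-monoˡ-≤ (sensitivity f) (length≤blockSensitivity f {x} ds))
    where
    differ : ∀ {Cs y C} → AgreeOn (concatMap elements Cs) x y → C ∈ Cs → ∀ i →
             lookup (x ⊕ y) i ≡ true → lookup C i ≡ true → ⊥
    differ {Cs} {y} {C} agree C∈ i p q = contradiction
      (trans (sym p) (trans (lookup-⊕ x y i)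
        (trans (cong (lookup x i xor_) (agree i∈)) (Bool.xor-same (lookup x i))))) λ ()
      where
      i∈ : i ∈ concatMap elements Cs
      i∈ = ∈-concatMap⁺ elements (Any.map (λ { refl → ∈-elements⁺ C q }) C∈)

-- Decision trees and the rank from above

agreeOn? : ∀ S (x : Cube n) → Decidable (AgreeOn S x)
agreeOn? S x y = map′ (λ a {i} → All.lookup a) (λ a → All.tabulate a)
  (All.all? (λ i → lookup y i Bool.≟ lookup x i) S)

data DecisionTree {n} : ℕ → BooleanFunction n → Set where
  leaf : ∀ {D g} b → (∀ x → g x ≡ b) → DecisionTree D g
  node : ∀ {D g g₀ g₁} i → DecisionTree D g₀ → DecisionTree D g₁ →
         (∀ x → g x ≡ (if lookup x i then g₁ x else g₀ x)) → DecisionTree (suc D) g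

weaken : ∀ {D E} {g : BooleanFunction n} → D ≤ E → DecisionTree D g → DecisionTree E g
weaken _ (leaf b eq) = leaf b eq
weaken (s≤s le) (node i t₀ t₁ eq) = node i (weaken le t₀) (weaken le t₁) eq

-- The tree has to be right only on `P`, the points consistent with the answers received so far.
ComputedOn : (Cube n → Set) → ℕ → BooleanFunction n → Set
ComputedOn P D f = ∃[ g ] DecisionTree D g × (∀ z → P z → g z ≡ f z)

module _ {f : BooleanFunction n} where

  computedOn-⊆ : ∀ {P Q : Cube n → Set} {D} → (∀ {z} → P z → Q z) → ComputedOn Q D f → ComputedOn P D f
  computedOn-⊆ P⊆Q (g , t , g≗f) = g , t , λ z p → g≗f z (P⊆Q p)

  query : ∀ {P D} i → (∀ b → ComputedOn (λ z → P z × lookup z i ≡ b) D f) → ComputedOn P (suc D) f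
  query {P} {D} i branch with branch false | branch true
  ... | g₀ , t₀ , eq₀ | g₁ , t₁ , eq₁ =
    (λ x → if lookup x i then g₁ x else g₀ x) , node i t₀ t₁ (λ _ → refl) , correct
    where
    correct : ∀ z → P z → (if lookup z i then g₁ z else g₀ z) ≡ f z
    correct z p with lookup z i in eq
    ... | false = eq₀ z (p , eq)
    ... | true  = eq₁ z (p , eq)

  queries : ∀ {P D} S → (∀ w → ComputedOn (λ z → P z × AgreeOn S w z) D f) →
            ComputedOn P (length S + D) f
  -- With nothing to query, any `w` serves.
  queries [] branch = computedOn-⊆ (λ p → p , λ ()) (branch (Vec.replicate _ false))
  queries {P} (i ∷ S) branch = query i λ b → queries S λ w →
    computedOn-⊆ (λ { {z} ((p , zi≡b) , agree) → p , extend w b {z} zi≡b agree }) (branch (w [ i ]≔ b))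
    where
    extend : ∀ w b {z} → lookup z i ≡ b → AgreeOn S w z → AgreeOn (i ∷ S) (w [ i ]≔ b) z
    extend w b zi≡b agree (here refl) = trans zi≡b (sym (lookup∘update i w b))
    extend w b zi≡b agree {j} (there j∈) with j Fin.≟ i
    ... | yes refl = trans zi≡b (sym (lookup∘update i w b))
    ... | no j≢i   = trans (agree j∈) (sym (lookup∘update′ j≢i w b))

module _ (f : BooleanFunction n) {C : ℕ}
         (certificates : ∀ x → ∃[ S ] Certificate f x S × length S ≤ C) where

  open DecMembership (Fin._≟_ {n}) using (_∈?_)

  private
    cert : Cube n → List (Fin n)
    cert x = proj₁ (certificates x)

    remaining : List (Fin n) → Cube n → List (Fin n)
    remaining S z = filter (λ i → ¬? (i ∈? S)) (cert z)

  -- Certificates of points with different values conflict: otherwise some point agrees with both.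
  certificates-meet : ∀ {S x z} → AgreeOn S x z → f x ≡ true → f z ≡ false →
                      ∃[ i ] i ∈ cert z × ¬ (i ∈ S) × i ∈ cert x
  certificates-meet {S} {x} {z} agree fx fz
    with Any.any? (λ i → ¬? (i ∈? S) ×-dec (i ∈? cert x)) (cert z)
  ... | yes ∃i = let i , i∈ , i∉S , i∈x = find ∃i in i , i∈ , i∉S , i∈x
  ... | no ∄i = contradiction
    (trans (sym fx) (trans (sym (proj₁ (proj₂ (certificates x)) u u~x))
      (trans (proj₁ (proj₂ (certificates z)) u u~z) fz))) λ ()
    where
    value : ∀ i → Dec (i ∈ cert x) → Bool
    value i (yes _) = lookup x i
    value i (no _)  = lookup z i
    -- The hybrid point follows `x` on the certificate of `x` and `z` elsewhere. A coordinate common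
    -- to both certificates would lie in `S`, where `x` and `z` agree, so `u` also follows `z` on
    -- the certificate of `z`.
    u : Cube n
    u = tabulate (λ i → value i (i ∈? cert x))
    u~x : AgreeOn (cert x) x u
    u~x {i} i∈ = trans (lookup∘tabulate _ i) (eq (i ∈? cert x))
      where
      eq : ∀ d → value i d ≡ lookup x i
      eq (yes _)  = refl
      eq (no i∉) = contradiction i∈ i∉
    u~z : AgreeOn (cert z) z u
    u~z {i} i∈ = trans (lookup∘tabulate _ i) (eq (i ∈? cert x))
      where
      eq : ∀ d → value i d ≡ lookup z i
      eq (no _)    = refl
      eq (yes i∈x) = sym (agree (decidable-stable (i ∈? S) λ i∉S →
        ∄i (Any.map (λ { refl → i∉S , i∈x }) i∈)))

  -- Querying a certificate of a 1-point shortens the certificates of all remaining 0-points.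
  computedOn-c*C : ∀ c S {P : Cube n → Set} → Decidable P →
    (∀ {x z} → P x → P z → AgreeOn S x z) →
    (∀ {z} → P z → f z ≡ false → length (remaining S z) ≤ c) →
    ComputedOn P (c * C) f
  computedOn-c*C c S {P} P? agree short with Any.any? (λ x → P? x ×-dec (f x Bool.≟ true)) (cube n)
  ... | no ∄x = (λ _ → false) , leaf false (λ _ → refl) , λ z p →
    sym (Bool.¬-not λ fz → ∄x (Any.map (λ { refl → p , fz }) (∈-cube z)))
  ... | yes ∃x with find ∃x
  -- A 0-point would still have an unqueried coordinate in its certificate; as `c` is zero, only
  -- 1-points are left.
  computedOn-c*C zero S {P} P? agree short | yes _ | x , _ , px , fx =
    (λ _ → true) , leaf true (λ _ → refl) , λ z pz → sym (Bool.¬-not λ fz →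
      let i , i∈z , i∉S , i∈x = certificates-meet {S} {x} {z} (agree px pz) fx fz in
      ℕ.<⇒≱ (filter-some (λ i → ¬? (i ∈? S)) (Any.map (λ { refl → i∉S }) i∈z)) (short pz fz))
  computedOn-c*C (suc c) S {P} P? agree short | yes _ | x , _ , px , fx =
    let g , t , eq = queries {f = f} (cert x) λ w → computedOn-c*C c (cert x ++ S)
          (λ z → P? z ×-dec agreeOn? (cert x) w z)
          (λ { {u} {z} (pu , au) (pz , az) i∈ → agree′ w {u} {z} pu au pz az i∈ })
          (λ { {z} (pz , _) fz → ℕ.≤-pred (ℕ.≤-trans (shorter z pz fz) (short pz fz)) })
    in g , weaken (ℕ.+-monoˡ-≤ (c * C) (proj₂ (proj₂ (certificates x)))) t , eq
    where
    agree′ : ∀ w {u z} → P u → AgreeOn (cert x) w u → P z → AgreeOn (cert x) w z →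
             AgreeOn (cert x ++ S) u z
    agree′ w pu au pz az i∈ with ∈-++⁻ (cert x) i∈
    ... | inj₁ i∈x = trans (az i∈x) (sym (au i∈x))
    ... | inj₂ i∈S = agree pu pz i∈S
    shorter : ∀ z → P z → f z ≡ false → length (remaining (cert x ++ S) z) < length (remaining S z)
    shorter z pz fz =
      let i , i∈z , i∉S , i∈x = certificates-meet {S} {x} {z} (agree px pz) fx fz in
      length-filter-< (λ i → ¬? (i ∈? (cert x ++ S))) (λ i → ¬? (i ∈? S))
        (λ i∉ i∈S → i∉ (∈-++⁺ʳ (cert x) i∈S)) i∈z i∉S (λ i∉ → i∉ (∈-++⁺ˡ i∈x))

  decisionTree : ∃[ g ] DecisionTree (C * C) g × (∀ x → g x ≡ f x)
  decisionTree =
    let g , t , eq = computedOn-c*C C [] {λ _ → ⊤} (λ _ → yes tt) (λ _ _ ())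
          (λ {z} _ _ → ℕ.≤-trans (length-filter (λ i → ¬? (i ∈? [])) (cert z))
                         (proj₂ (proj₂ (certificates z))))
    in g , t , λ x → eq x tt

-- Linear spans by duality, and the rank of a decision tree

combination : ∀ {X : Set} {k} → (Fin k → ℝ) → (Fin k → X) → (X → ℚ) → ℝ
combination c ys φ = sum (λ i → c i *ᴿ fromℚ (φ (ys i)))

-- φ lies in the linear span of L, expressed by duality.
record Spans {X : Set} (L : List (X → ℚ)) (φ : X → ℚ) : Set where
  constructor mkSpans
  field
    vanishes : ∀ {k} (c : Fin k → ℝ) (ys : Fin k → X) →
      (∀ {ψ} → ψ ∈ L → combination c ys ψ ≈ᴿ 0ᴿ) → combination c ys φ ≈ᴿ 0ᴿ

open Spans

-- Gaussian elimination: an entry of `xs` either gives a pivot, which uses up one vector, or is a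
-- zero coordinate of all of them; no vector can be left when `xs` is exhausted.
independentOn⇒≤ : ∀ {X : Set} {k} xs {v : Fin k → X → ℚ} →
                  Elimination.IndependentOn xs v → k ≤ length xs
independentOn⇒≤ {k = zero} xs I = z≤n
independentOn⇒≤ {k = suc k} [] I =
  contradiction (I (λ _ → 1ᴿ) (λ ()) zero) (Elimination.1≉0 {ℕ})
independentOn⇒≤ {X} {suc k} (x ∷ xs) {v} I with Fin.any? (λ i → ¬? (v i x ℚ.≟ 0ℚ))
... | yes (i , vix≢0) = s≤s (independentOn⇒≤ xs {Pivot.w} (Pivot.to I))
  where
  instance
    vix-nonZero : ℚ.NonZero (v i x)
    vix-nonZero = ℚ.≢-nonZero vix≢0
  module Pivot = Elimination.Pivot v x i (1/ v i x) (ℚ.*-inverseʳ (v i x))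
... | no ¬pivot = ℕ.m≤n⇒m≤1+n (independentOn⇒≤ xs {v} λ c eqs → I c λ
  { (here refl) → Elimination.lin-zero v c _ (λ i → decidable-stable (v i x ℚ.≟ 0ℚ) (λ ne → ¬pivot (i , ne)))
  ; (there y∈)  → eqs y∈ })

-- Elimination runs with the functions in `L` as coordinates: column `y` becomes the vector of
-- values ψ(y), and by `spans` a relation among these vectors is a relation among the columns of
-- `M`.
rank≤ : ∀ (M : Cube n → Cube n → ℚ) L → (∀ x → Spans L (M x)) → rank M ≤ length L
rank≤ {n} M L spans = max≤ bound
  where
  bound : ∀ {m} → m ∈ map length (filter (independent? M) (sublists (cube n))) → m ≤ length L
  bound m∈ with ∈-map⁻ length m∈
  ... | ys , ys∈ , refl = independentOn⇒≤ L {λ i ψ → ψ (List.lookup ys i)} λ c eqs →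
    proj₂ (∈-filter⁻ (independent? M) {xs = sublists (cube n)} ys∈) c
      (λ x → vanishes (spans x) c (List.lookup ys) eqs)

module _ {X : Set} where

  spans-∈ : ∀ {L} {φ : X → ℚ} → φ ∈ L → Spans L φ
  spans-∈ φ∈ = mkSpans λ c ys eqs → eqs φ∈

  spans-⊆ : ∀ {L L′} {φ : X → ℚ} → (∀ {ψ} → ψ ∈ L → ψ ∈ L′) → Spans L φ → Spans L′ φ
  spans-⊆ L⊆L′ s = mkSpans λ c ys eqs → vanishes s c ys (eqs ∘ L⊆L′)

  spans-cong : ∀ {L} {φ ψ : X → ℚ} → (∀ y → φ y ≡ ψ y) → Spans L φ → Spans L ψ
  spans-cong {φ = φ} {ψ} φ≗ψ s = mkSpans λ c ys eqs → ≈-trans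
    (sum-cong-≋ (λ i → ℝ-ring.reflexive (cong (λ q → c i *ᴿ fromℚ q) (sym (φ≗ψ (ys i))))))
    (vanishes s c ys eqs)

  spans-0 : ∀ {L : List (X → ℚ)} → Spans L (λ _ → 0ℚ)
  spans-0 = mkSpans λ c ys _ → Elimination.lin-zero (λ i _ → 0ℚ) c tt (λ _ → refl)

  spans-+ : ∀ {L} {φ ψ : X → ℚ} → Spans L φ → Spans L ψ → Spans L (λ y → φ y +ℚ ψ y)
  spans-+ {φ = φ} {ψ} s t = mkSpans λ c ys eqs → ≈-trans
    (≈-trans (sum-cong-≋ (λ i → pointwise⇒≈ (λ m → ℚ.*-distribˡ-+ (seq (c i) m) (φ (ys i)) (ψ (ys i)))))
      (∑-distrib-+ (λ i → c i *ᴿ fromℚ (φ (ys i))) (λ i → c i *ᴿ fromℚ (ψ (ys i)))))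
    (≈-trans (+ᴿ-cong (vanishes s c ys eqs) (vanishes t c ys eqs)) (ℝ-ring.+-identityˡ 0ᴿ))

  restrictTo : (X → Bool) → (X → ℚ) → X → ℚ
  restrictTo P φ y = if P y then φ y else 0ℚ

  module _ (P : X → Bool) where

    combination-restrictTo : ∀ {k} (c : Fin k → ℝ) ys φ →
      combination (λ i → if P (ys i) then c i else 0ᴿ) ys φ ≈ᴿ combination c ys (restrictTo P φ)
    combination-restrictTo c ys φ = sum-cong-≋ term
      where
      term : ∀ i → (if P (ys i) then c i else 0ᴿ) *ᴿ fromℚ (φ (ys i)) ≈ᴿ
                   c i *ᴿ fromℚ (restrictTo P φ (ys i))
      term i with P (ys i)
      ... | true  = ≈-refl
      ... | false = pointwise⇒≈ (λ m → trans (ℚ.*-zeroˡ (φ (ys i))) (sym (ℚ.*-zeroʳ (seq (c i) m))))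

    -- By duality, cutting functions down to `P` amounts to zeroing the coefficients at points
    -- outside `P`.
    spans-restrictTo : ∀ {L} {φ : X → ℚ} → Spans L φ → Spans (map (restrictTo P) L) (restrictTo P φ)
    spans-restrictTo {φ = φ} s = mkSpans λ c ys eqs → ≈-trans
      (≈-sym (combination-restrictTo c ys φ))
      (vanishes s _ ys λ {ψ} ψ∈ →
        ≈-trans (combination-restrictTo c ys ψ) (eqs (∈-map⁺ (restrictTo P) ψ∈)))

coordinateIs : Fin n → Bool → Cube n → Bool
coordinateIs i b y = not (b xor lookup y i)

-- At a node querying `i`, x ⊕ y goes to `g₀` exactly if y agrees with x at `i`. Each row is thus
-- glued from a row of `g₀` on one half of the cube and a row of `g₁` on the other. Which half is
-- which depends on x, so both lists are restricted to both halves: a factor of 4 per level.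
decisionTree⇒spans : ∀ {D} {g : BooleanFunction n} → DecisionTree D g →
  ∃[ L ] length L ≤ 4 ^ D × (∀ x → Spans L (xorMatrix g x))
decisionTree⇒spans {D = D} {g} (leaf b g≗b) = (λ _ → 1ℚ) ∷ [] , ℕ.m^n>0 4 D , λ x →
  spans-cong (λ y → sym (cong toℚ (g≗b (x ⊕ y)))) (const b)
  where
  const : ∀ b → Spans ((λ _ → 1ℚ) ∷ []) (λ _ → toℚ b)
  const false = spans-0
  const true  = spans-∈ (here refl)
decisionTree⇒spans {D = suc D} {g} (node {g₀ = g₀} {g₁} i t₀ t₁ eq)
  with decisionTree⇒spans t₀ | decisionTree⇒spans t₁
... | L₀ , l₀ , s₀ | L₁ , l₁ , s₁ = on false ++ on true , size , spans
  where
  on : Bool → List (Cube _ → ℚ)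
  on b = map (restrictTo (coordinateIs i b)) (L₀ ++ L₁)
  on-size : ∀ b → length (on b) ≤ 4 ^ D + 4 ^ D
  on-size b = subst (_≤ 4 ^ D + 4 ^ D)
    (sym (trans (length-map _ (L₀ ++ L₁)) (length-++ L₀))) (ℕ.+-mono-≤ l₀ l₁)
  size : length (on false ++ on true) ≤ 4 ^ suc D
  size = begin
    length (on false ++ on true)            ≡⟨ length-++ (on false) ⟩
    length (on false) + length (on true)    ≤⟨ ℕ.+-mono-≤ (on-size false) (on-size true) ⟩
    (4 ^ D + 4 ^ D) + (4 ^ D + 4 ^ D)       ≡⟨ ℕ.+-assoc (4 ^ D) (4 ^ D) _ ⟩
    4 ^ D + (4 ^ D + (4 ^ D + 4 ^ D))       ≡⟨ cong (λ t → 4 ^ D + (4 ^ D + (4 ^ D + t))) (sym (ℕ.+-identityʳ (4 ^ D))) ⟩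
    4 ^ suc D                               ∎
    where open ℕ.≤-Reasoning
  on-⊆ : ∀ b {ψ} → ψ ∈ on b → ψ ∈ on false ++ on true
  on-⊆ false ψ∈ = ∈-++⁺ˡ ψ∈
  on-⊆ true  ψ∈ = ∈-++⁺ʳ (on false) ψ∈
  spans : ∀ x → Spans (on false ++ on true) (xorMatrix g x)
  spans x = spans-cong split (spans-+
    (spans-⊆ (on-⊆ (lookup x i)) (spans-restrictTo _ (spans-⊆ ∈-++⁺ˡ (s₀ x))))
    (spans-⊆ (on-⊆ (not (lookup x i))) (spans-restrictTo _ (spans-⊆ (∈-++⁺ʳ L₀) (s₁ x)))))
    where
    split : ∀ y → restrictTo (coordinateIs i (lookup x i)) (xorMatrix g₀ x) y +ℚ
                  restrictTo (coordinateIs i (not (lookup x i))) (xorMatrix g₁ x) y ≡ xorMatrix g x y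
    split y = sym (trans (cong toℚ (eq (x ⊕ y)))
      (trans (cong (λ b → toℚ (if b then g₁ (x ⊕ y) else g₀ (x ⊕ y))) (lookup-⊕ x y i))
        (cases (lookup x i) (lookup y i))))
      where
      cases : ∀ a b → toℚ (if a xor b then g₁ (x ⊕ y) else g₀ (x ⊕ y)) ≡
        (if not (a xor b) then xorMatrix g₀ x y else 0ℚ) +ℚ
        (if not (not a xor b) then xorMatrix g₁ x y else 0ℚ)
      cases false false = sym (ℚ.+-identityʳ _)
      cases false true  = sym (ℚ.+-identityˡ _)
      cases true  false = sym (ℚ.+-identityˡ _)
      cases true  true  = sym (ℚ.+-identityʳ _)

rank-xorMatrix≤ : ∀ (f : BooleanFunction n) →
  let C = blockSensitivity f * sensitivity f in rank (xorMatrix f) ≤ 4 ^ (C * C)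
rank-xorMatrix≤ f =
  let g , t , g≗f = decisionTree f (small-certificate f)
      L , size , spans = decisionTree⇒spans t
  in ℕ.≤-trans (rank≤ (xorMatrix f) L
       (λ x → spans-cong (λ y → cong toℚ (g≗f (x ⊕ y))) (spans x))) size

-- Conjunctions of pairs of variables and the rank from below

unique-lookup : ∀ {xs : List A} → Unique xs → ∀ {i j} → List.lookup xs i ≡ List.lookup xs j → i ≡ j
unique-lookup (_ ∷ _) {zero} {zero} _ = refl
unique-lookup (x∉ ∷ _) {zero} {suc j} eq = contradiction eq (All.lookup x∉ (∈-lookup j))
unique-lookup (x∉ ∷ _) {suc i} {zero} eq = contradiction (sym eq) (All.lookup x∉ (∈-lookup i))
unique-lookup (_ ∷ xs!) {suc i} {suc j} eq = cong suc (unique-lookup xs! eq)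

module _ {X : Set} where

  spans-* : ∀ {L} {φ : X → ℚ} q → Spans L φ → Spans L (λ y → φ y *ℚ q)
  spans-* {φ = φ} q s = mkSpans λ c ys eqs → ≈-trans
    (sum-cong-≋ (λ i → pointwise⇒≈ (λ m → sym (ℚ.*-assoc (seq (c i) m) (φ (ys i)) q))))
    (≈-trans (≈-sym (*-distribʳ-sum (fromℚ q) (λ i → c i *ᴿ fromℚ (φ (ys i)))))
      (≈-trans (*ᴿ-cong (vanishes s c ys eqs) ≈-refl) (ℝ-ring.zeroˡ (fromℚ q))))

  spans-- : ∀ {L} {φ ψ : X → ℚ} → Spans L φ → Spans L ψ → Spans L (λ y → φ y -ℚ ψ y)
  spans-- {φ = φ} {ψ} s t = spans-cong
    (λ y → cong (φ y +ℚ_) (trans (sym (ℚ.neg-distribʳ-* (ψ y) 1ℚ)) (cong -ℚ_ (ℚ.*-identityʳ (ψ y)))))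
    (spans-+ s (spans-* (-ℚ 1ℚ) t))

  combination-single : ∀ {k} (c : Fin k → ℝ) (ys : Fin k → X) (φ : X → ℚ) i →
    (∀ j → j ≢ i → φ (ys j) ≡ 0ℚ) → combination c ys φ ≈ᴿ c i *ᴿ fromℚ (φ (ys i))
  combination-single {suc k} c ys φ i others = ≈-trans (sum-remove (λ j → c j *ᴿ fromℚ (φ (ys j))))
    (≈-trans (+ᴿ-cong ≈-refl rest≈0) (ℝ-ring.+-identityʳ _))
    where
    rest≈0 : sum (λ j → c (punchIn i j) *ᴿ fromℚ (φ (ys (punchIn i j)))) ≈ᴿ 0ᴿ
    rest≈0 = ≈-trans
      (sum-cong-≋ (λ j → pointwise⇒≈ (λ m → trans
        (cong (seq (c (punchIn i j)) m *ℚ_) (others (punchIn i j) (punchInᵢ≢i i j)))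
        (ℚ.*-zeroʳ (seq (c (punchIn i j)) m)))))
      (sum-replicate-zero k)

*-nonzero-cancel : ∀ {r} q → q ≢ 0ℚ → r *ᴿ fromℚ q ≈ᴿ 0ᴿ → r ≈ᴿ 0ᴿ
*-nonzero-cancel {r} q q≢0 e = ≈-trans
  (pointwise⇒≈ (λ m → sym (trans (ℚ.*-assoc (seq r m) q (1/ q))
    (trans (cong (seq r m *ℚ_) (ℚ.*-inverseʳ q)) (ℚ.*-identityʳ (seq r m))))))
  (≈-trans (*ᴿ-cong {y = fromℚ (1/ q)} e ≈-refl) (ℝ-ring.zeroˡ (fromℚ (1/ q))))
  where
  instance
    q-nonZero : ℚ.NonZero q
    q-nonZero = ℚ.≢-nonZero q≢0

-- Columns having a biorthogonal system in the row space are independent.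
≤rank : ∀ (M : Cube n → Cube n → ℚ) {ys} → Unique ys →
  (∀ {y} → y ∈ ys → ∃[ φ ] Spans (map M (cube n)) φ × φ y ≢ 0ℚ ×
                          (∀ {z} → z ∈ ys → z ≢ y → φ z ≡ 0ℚ)) →
  length ys ≤ rank M
≤rank {n} M {ys} ys! dual with unique⇒↭sublist _≟ᶜ_ ys! (λ {y} _ → ∈-cube y)
... | zs , zs∈ , ys↭zs = subst (_≤ rank M) (sym (↭-length ys↭zs))
  (∈⇒≤max (∈-map⁺ length (∈-filter⁺ (independent? M) zs∈ independent)))
  where
  zs! = Unique-resp-↭ ys↭zs ys!
  ∈ys : ∀ i → List.lookup zs i ∈ ys
  ∈ys i = ∈-resp-↭ (↭-sym ys↭zs) (∈-lookup i)
  independent : LinearlyIndependent (columns M zs)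
  independent c eqs i with dual (∈ys i)
  ... | φ , s , φi≢0 , φ-others = *-nonzero-cancel (φ (List.lookup zs i)) φi≢0 (≈-trans
    (≈-sym (combination-single c (List.lookup zs) φ i λ j j≢i →
      φ-others (∈ys j) (j≢i ∘ unique-lookup zs!)))
    (vanishes s c (List.lookup zs) λ ψ∈ → row (∈-map⁻ M ψ∈)))
    where
    row : ∀ {ψ} → (∃[ x ] x ∈ cube n × ψ ≡ M x) → combination c (List.lookup zs) ψ ≈ᴿ 0ᴿ
    row (x , _ , refl) = eqs x

-- alternating T h = Σ_{S ⊆ T} (-1)^{|T ∖ S|} h(S), the coefficient of ∏_{i ∈ T} zᵢ in the
-- multilinear polynomial of h.
alternating : Subset n → (Cube n → ℚ) → ℚ
alternating []          h = h []
alternating (false ∷ T) h = alternating T (h ∘ (false ∷_))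
alternating (true ∷ T)  h = alternating T (h ∘ (true ∷_)) -ℚ alternating T (h ∘ (false ∷_))

alternating-cong : ∀ (T : Subset n) {g h} → (∀ S → g S ≡ h S) → alternating T g ≡ alternating T h
alternating-cong []          g≗h = g≗h []
alternating-cong (false ∷ T) g≗h = alternating-cong T (g≗h ∘ (false ∷_))
alternating-cong (true ∷ T)  g≗h = cong₂ _-ℚ_ (alternating-cong T (g≗h ∘ (true ∷_)))
                                              (alternating-cong T (g≗h ∘ (false ∷_)))

spans-alternating : ∀ {X : Set} {L} (T : Subset n) {φ : Cube n → X → ℚ} →
                    (∀ S → Spans L (φ S)) → Spans L (λ y → alternating T (λ S → φ S y))
spans-alternating []          s = s []
spans-alternating (false ∷ T) s = spans-alternating T (s ∘ (false ∷_))
spans-alternating (true ∷ T)  s = spans-- (spans-alternating T (s ∘ (true ∷_)))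
                                          (spans-alternating T (s ∘ (false ∷_)))

subsets : Subset n → List (Subset n)
subsets []          = [] ∷ []
subsets (false ∷ T) = map (false ∷_) (subsets T)
subsets (true ∷ T)  = map (false ∷_) (subsets T) ++ map (true ∷_) (subsets T)

length-subsets : ∀ (T : Subset n) → length (subsets T) ≡ 2 ^ ∥ T ∥
length-subsets []          = refl
length-subsets (false ∷ T) = trans (length-map (false ∷_) (subsets T)) (length-subsets T)
length-subsets (true ∷ T)  = trans (length-++ (map (false ∷_) (subsets T)))
  (cong₂ _+_ (trans (length-map (false ∷_) (subsets T)) (length-subsets T))
    (trans (trans (length-map (true ∷_) (subsets T)) (length-subsets T)) (sym (ℕ.+-identityʳ _))))

subsets-unique : ∀ (T : Subset n) → Unique (subsets T)
subsets-unique []          = [] ∷ []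
subsets-unique (false ∷ T) = Unique.map⁺ Vec.∷-injectiveʳ (subsets-unique T)
subsets-unique (true ∷ T)  = Unique.++⁺
  (Unique.map⁺ Vec.∷-injectiveʳ (subsets-unique T))
  (Unique.map⁺ Vec.∷-injectiveʳ (subsets-unique T))
  λ (p , q) → disjoint (∈-map⁻ (false ∷_) p) (∈-map⁻ (true ∷_) q)
  where
  disjoint : ∀ {S} → (∃[ U ] U ∈ subsets T × S ≡ false ∷ U) →
             (∃[ U ] U ∈ subsets T × S ≡ true ∷ U) → ⊥
  disjoint (_ , _ , refl) (_ , _ , ())

∈-subsets⇒⊆ : ∀ (T : Subset n) {S} → S ∈ subsets T → S ⊆ᵇ T
∈-subsets⇒⊆ []          S∈ ()
∈-subsets⇒⊆ (false ∷ T) S∈ i p with ∈-map⁻ (false ∷_) S∈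
∈-subsets⇒⊆ (false ∷ T) S∈ (suc i) p | U , U∈ , refl = ∈-subsets⇒⊆ T U∈ i p
∈-subsets⇒⊆ (true ∷ T)  S∈ zero    p = refl
∈-subsets⇒⊆ (true ∷ T)  S∈ (suc i) p with ∈-++⁻ (map (false ∷_) (subsets T)) S∈
... | inj₁ S∈′ with ∈-map⁻ (false ∷_) S∈′
...   | U , U∈ , refl = ∈-subsets⇒⊆ T U∈ i p
∈-subsets⇒⊆ (true ∷ T)  S∈ (suc i) p | inj₂ S∈′ with ∈-map⁻ (true ∷_) S∈′
...   | U , U∈ , refl = ∈-subsets⇒⊆ T U∈ i p

-- In each coordinate i ∈ T, row ε S is (0,0) if i ∉ S and otherwise (1,0) or (0,1) according to ε,
-- while column T δ is (0,1) or (1,0) according to δ. The conjunction of their sum is then 1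
-- exactly if i ∈ S and ε, δ agree at i.
columnˡ rowˡ rowʳ : Subset n → Subset n → Cube n
columnˡ T δ = T ∩ ∁ δ
rowˡ ε S = S ∩ ε
rowʳ ε S = S ∩ ∁ ε

meet : Subset n → Subset n → Subset n → Subset n → Cube n
meet T ε δ S = (rowˡ ε S ⊕ columnˡ T δ) ∩ (rowʳ ε S ⊕ δ)

-- On the subsets of `T`, `meet T ε ε` is the identity.
alternating-meet-same : ∀ (T ε : Subset n) h → alternating T (h ∘ meet T ε ε) ≡ alternating T h
alternating-meet-same [] [] h = refl
alternating-meet-same (false ∷ T) (e ∷ ε) h =
  alternating-meet-same T ε (h ∘ (false ∷_))
alternating-meet-same (true ∷ T) (false ∷ ε) h =
  cong₂ _-ℚ_ (alternating-meet-same T ε (h ∘ (true ∷_))) (alternating-meet-same T ε (h ∘ (false ∷_)))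
alternating-meet-same (true ∷ T) (true ∷ ε) h =
  cong₂ _-ℚ_ (alternating-meet-same T ε (h ∘ (true ∷_))) (alternating-meet-same T ε (h ∘ (false ∷_)))

-- As both are subsets of `T`, `ε` and `δ` differ at a coordinate of `T`. There the conjunction is 0
-- whether or not `S` contains it, so the two halves of the alternating sum cancel.
alternating-meet-distinct : ∀ (T ε δ : Subset n) h → ε ⊆ᵇ T → δ ⊆ᵇ T → δ ≢ ε →
                            alternating T (h ∘ meet T ε δ) ≡ 0ℚ
alternating-meet-distinct [] [] [] h _ _ δ≢ε = contradiction refl δ≢ε
alternating-meet-distinct (false ∷ T) (true ∷ ε) (d ∷ δ) h ε⊆ δ⊆ δ≢ε = contradiction (ε⊆ zero refl) λ ()
alternating-meet-distinct (false ∷ T) (false ∷ ε) (true ∷ δ) h ε⊆ δ⊆ δ≢ε = contradiction (δ⊆ zero refl) λ ()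
alternating-meet-distinct (false ∷ T) (false ∷ ε) (false ∷ δ) h ε⊆ δ⊆ δ≢ε =
  alternating-meet-distinct T ε δ (h ∘ (false ∷_)) (ε⊆ ∘ suc) (δ⊆ ∘ suc) (δ≢ε ∘ cong (false ∷_))
alternating-meet-distinct (true ∷ T) (false ∷ ε) (false ∷ δ) h ε⊆ δ⊆ δ≢ε =
  cong₂ _-ℚ_
    (alternating-meet-distinct T ε δ (h ∘ (true ∷_)) (ε⊆ ∘ suc) (δ⊆ ∘ suc) (δ≢ε ∘ cong (false ∷_)))
    (alternating-meet-distinct T ε δ (h ∘ (false ∷_)) (ε⊆ ∘ suc) (δ⊆ ∘ suc) (δ≢ε ∘ cong (false ∷_)))
alternating-meet-distinct (true ∷ T) (true ∷ ε) (true ∷ δ) h ε⊆ δ⊆ δ≢ε =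
  cong₂ _-ℚ_
    (alternating-meet-distinct T ε δ (h ∘ (true ∷_)) (ε⊆ ∘ suc) (δ⊆ ∘ suc) (δ≢ε ∘ cong (true ∷_)))
    (alternating-meet-distinct T ε δ (h ∘ (false ∷_)) (ε⊆ ∘ suc) (δ⊆ ∘ suc) (δ≢ε ∘ cong (true ∷_)))
alternating-meet-distinct (true ∷ T) (false ∷ ε) (true ∷ δ) h ε⊆ δ⊆ δ≢ε =
  ℚ.+-inverseʳ (alternating T (h ∘ (false ∷_) ∘ meet T ε δ))
alternating-meet-distinct (true ∷ T) (true ∷ ε) (false ∷ δ) h ε⊆ δ⊆ δ≢ε =
  ℚ.+-inverseʳ (alternating T (h ∘ (false ∷_) ∘ meet T ε δ))

-- The conjunction gadget: sensitivity and rank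

gadget : BooleanFunction n → Cube n → BooleanFunction (n + n)
gadget {n} f x z = f (x ⊕ (Vec.take n z ∩ Vec.drop n z))

gadget-++ : ∀ (f : BooleanFunction n) x u v → gadget f x (u Vec.++ v) ≡ f (x ⊕ (u ∩ v))
gadget-++ {n} f x u v =
  let u≡ , v≡ = Vec.++-injective (Vec.take n (u Vec.++ v)) u (take++drop≡id n (u Vec.++ v))
  in cong₂ (λ u v → f (x ⊕ (u ∩ v))) u≡ v≡

⁅↑ˡ⁆ : ∀ (i : Fin n) m → ⁅ i ↑ˡ m ⁆ ≡ ⁅ i ⁆ Vec.++ replicate m false
⁅↑ˡ⁆ {suc n} zero    m = cong (true ∷_) (replicate-++ n m)
  where
  replicate-++ : ∀ n m → replicate (n + m) false ≡ replicate n false Vec.++ replicate m false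
  replicate-++ zero    m = refl
  replicate-++ (suc n) m = cong (false ∷_) (replicate-++ n m)
⁅↑ˡ⁆ (suc i) m = cong (false ∷_) (⁅↑ˡ⁆ i m)

⁅↑ʳ⁆ : ∀ m (i : Fin n) → ⁅ m ↑ʳ i ⁆ ≡ replicate m false Vec.++ ⁅ i ⁆
⁅↑ʳ⁆ zero    i = refl
⁅↑ʳ⁆ (suc m) i = cong (false ∷_) (⁅↑ʳ⁆ m i)

⊕-identityʳ : ∀ (x : Cube n) → x ⊕ replicate n false ≡ x
⊕-identityʳ = Vec.zipWith-identityʳ Bool.xor-identityʳ

toggle-∩ : ∀ (u v : Cube n) i → (u ⊕ ⁅ i ⁆) ∩ v ≡ (if lookup v i then (u ∩ v) ⊕ ⁅ i ⁆ else u ∩ v)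
toggle-∩ (a ∷ u) (false ∷ v) zero = cong₂ _∷_
  (trans (Bool.∧-zeroʳ (a xor true)) (sym (Bool.∧-zeroʳ a))) (cong (_∩ v) (⊕-identityʳ u))
toggle-∩ (a ∷ u) (true ∷ v) zero = cong₂ _∷_
  (trans (Bool.∧-identityʳ (a xor true)) (cong (_xor true) (sym (Bool.∧-identityʳ a))))
  (trans (cong (_∩ v) (⊕-identityʳ u)) (sym (⊕-identityʳ (u ∩ v))))
toggle-∩ (a ∷ u) (b ∷ v) (suc i) with lookup v i | toggle-∩ u v i
... | false | eq = cong₂ _∷_ (cong (_∧ b) (Bool.xor-identityʳ a)) eq
... | true  | eq = cong₂ _∷_
  (trans (cong (_∧ b) (Bool.xor-identityʳ a)) (sym (Bool.xor-identityʳ (a ∧ b)))) eq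

module _ (f : BooleanFunction n) (x : Cube n) where

  private
    point : Cube (n + n) → Cube n
    point z = x ⊕ (Vec.take n z ∩ Vec.drop n z)

    toggled : ∀ u v i → f (x ⊕ ((u ⊕ ⁅ i ⁆) ∩ v)) ≢ f (x ⊕ (u ∩ v)) → Sensitive f (x ⊕ (u ∩ v)) ⁅ i ⁆
    toggled u v i ne eq with lookup v i | toggle-∩ u v i
    ... | false | e = ne (cong (λ t → f (x ⊕ t)) e)
    ... | true  | e = ne (trans (cong (λ t → f (x ⊕ t)) e)
                            (trans (cong f (sym (⊕-assoc x (u ∩ v) ⁅ i ⁆))) eq))

    split-⊕ : ∀ z (w w′ : Cube n) → gadget f x (z ⊕ (w Vec.++ w′)) ≡
              f (x ⊕ ((Vec.take n z ⊕ w) ∩ (Vec.drop n z ⊕ w′)))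
    split-⊕ z w w′ = trans
      (cong (gadget f x) (trans (cong (_⊕ (w Vec.++ w′)) (sym (take++drop≡id n z)))
        (zipWith-++ _xor_ (Vec.take n z) (Vec.drop n z) w w′)))
      (gadget-++ f x _ _)

  gadget-sensitiveˡ : ∀ z i → Sensitive (gadget f x) z ⁅ i ↑ˡ n ⁆ → Sensitive f (point z) ⁅ i ⁆
  gadget-sensitiveˡ z i s = toggled (Vec.take n z) (Vec.drop n z) i λ eq → s
    (trans (cong (λ e → gadget f x (z ⊕ e)) (⁅↑ˡ⁆ i n))
      (trans (split-⊕ z ⁅ i ⁆ _)
        (trans (cong (λ t → f (x ⊕ ((Vec.take n z ⊕ ⁅ i ⁆) ∩ t))) (⊕-identityʳ (Vec.drop n z))) eq)))

  gadget-sensitiveʳ : ∀ z i → Sensitive (gadget f x) z ⁅ n ↑ʳ i ⁆ → Sensitive f (point z) ⁅ i ⁆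
  gadget-sensitiveʳ z i s = subst (λ p → Sensitive f (x ⊕ p) ⁅ i ⁆) (∩-comm _ _)
    (toggled (Vec.drop n z) (Vec.take n z) i λ eq → s
    (trans (cong (λ e → gadget f x (z ⊕ e)) (⁅↑ʳ⁆ n i))
      (trans (split-⊕ z _ ⁅ i ⁆)
        (trans (cong (λ t → f (x ⊕ (t ∩ (Vec.drop n z ⊕ ⁅ i ⁆)))) (⊕-identityʳ (Vec.take n z)))
          (trans (cong (λ t → f (x ⊕ t)) (∩-comm _ _))
            (trans eq (cong (λ t → f (x ⊕ t)) (∩-comm _ _))))))))

  -- Toggling one conjunct either leaves the conjunction alone or toggles its coordinate. Each
  -- sensitive variable thus lies over a sensitive coordinate of `f` at `point z`, and two variables
  -- lie over each coordinate.
  sensitivity-gadget : sensitivity (gadget f x) ≤ 2 * sensitivity f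
  sensitivity-gadget = max≤ bound
    where
    bound : ∀ {m} → m ∈ map (sensitivityAt (gadget f x)) (cube (n + n)) → m ≤ 2 * sensitivity f
    bound m∈ with ∈-map⁻ (sensitivityAt (gadget f x)) m∈
    ... | z , _ , refl = begin
      sensitivityAt (gadget f x) z             ≤⟨ unique-⊆⇒length-≤ Fin._≟_ (Unique.filter⁺ sens? (Unique.allFin⁺ (n + n))) covered ⟩
      length (map (_↑ˡ n) S ++ map (n ↑ʳ_) S)  ≡⟨ length-++ (map (_↑ˡ n) S) ⟩
      length (map (_↑ˡ n) S) + length (map (n ↑ʳ_) S)
                                               ≡⟨ cong₂ _+_ (length-map (_↑ˡ n) S) (trans (length-map (n ↑ʳ_) S) (sym (ℕ.+-identityʳ _))) ⟩
      2 * length S                             ≤⟨ ℕ.*-monoʳ-≤ 2 (sensitivityAt≤sensitivity f (point z)) ⟩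
      2 * sensitivity f                        ∎
      where
      open ℕ.≤-Reasoning
      sens? = λ i → sensitive? (gadget f x) z ⁅ i ⁆
      S = filter (λ i → sensitive? f (point z) ⁅ i ⁆) (allFin n)
      covered : ∀ {i} → i ∈ filter sens? (allFin (n + n)) → i ∈ map (_↑ˡ n) S ++ map (n ↑ʳ_) S
      covered {i} i∈ with splitAt n i in eq
      ... | inj₁ j rewrite sym (splitAt⁻¹-↑ˡ {n} eq) = ∈-++⁺ˡ (∈-map⁺ (_↑ˡ n)
        (∈-filter⁺ _ (∈-allFin j) (gadget-sensitiveˡ z j (proj₂ (∈-filter⁻ sens? {xs = allFin (n + n)} i∈)))))
      ... | inj₂ j rewrite sym (splitAt⁻¹-↑ʳ {n} eq) = ∈-++⁺ʳ (map (_↑ˡ n) S) (∈-map⁺ (n ↑ʳ_)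
        (∈-filter⁺ _ (∈-allFin j) (gadget-sensitiveʳ z j (proj₂ (∈-filter⁻ sens? {xs = allFin (n + n)} i∈)))))

  -- The columns `column δ` with δ ⊆ T are independent: the alternating sum of the rows `row ε S`
  -- takes the nonzero coefficient at `T` as its value on `column ε` and vanishes on the others.
  2^≤rank-gadget : ∀ T → alternating T (λ z → toℚ (f (x ⊕ z))) ≢ 0ℚ →
                   2 ^ ∥ T ∥ ≤ rank (xorMatrix (gadget f x))
  2^≤rank-gadget T coefficient≢0 = subst (_≤ rank M)
    (trans (length-map column (subsets T)) (length-subsets T))
    (≤rank M (Unique.map⁺ (λ {δ} {ε} → Vec.++-injectiveʳ (columnˡ T δ) (columnˡ T ε)) (subsets-unique T)) dual)
    where
    M : Cube (n + n) → Cube (n + n) → ℚ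
    M = xorMatrix (gadget f x)
    h : Cube n → ℚ
    h z = toℚ (f (x ⊕ z))
    column : Subset n → Cube (n + n)
    column δ = columnˡ T δ Vec.++ δ
    row : Subset n → Subset n → Cube (n + n)
    row ε S = rowˡ ε S Vec.++ rowʳ ε S
    entry : ∀ ε δ S → M (row ε S) (column δ) ≡ h (meet T ε δ S)
    entry ε δ S = cong toℚ (trans
      (cong (gadget f x) (zipWith-++ _xor_ (rowˡ ε S) (rowʳ ε S) (columnˡ T δ) δ))
      (gadget-++ f x _ _))
    functional : Subset n → Cube (n + n) → ℚ
    functional ε y = alternating T (λ S → M (row ε S) y)
    dual : ∀ {y} → y ∈ map column (subsets T) →
      ∃[ φ ] Spans (map M (cube (n + n))) φ × φ y ≢ 0ℚ ×
             (∀ {z} → z ∈ map column (subsets T) → z ≢ y → φ z ≡ 0ℚ)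
    dual y∈ with ∈-map⁻ column y∈
    ... | ε , ε∈ , refl = functional ε
      , spans-alternating T (λ S → spans-∈ (∈-map⁺ M (∈-cube (row ε S))))
      , (λ eq → coefficient≢0 (trans (sym (alternating-meet-same T ε h))
          (trans (sym (alternating-cong T (entry ε ε))) eq)))
      , λ z∈ → others (∈-map⁻ column z∈)
      where
      others : ∀ {z} → (∃[ δ ] δ ∈ subsets T × z ≡ column δ) → z ≢ column ε → functional ε z ≡ 0ℚ
      others (δ , δ∈ , refl) z≢ = trans (alternating-cong T (entry ε δ))
        (alternating-meet-distinct T ε δ h (∈-subsets⇒⊆ T ε∈) (∈-subsets⇒⊆ T δ∈) (z≢ ∘ cong column))

-- Finite differences and interpolation

ι : ℕ → ℚ
ι k = ℤ.+ k / 1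

ι-suc : ∀ k → ι (suc k) ≡ ι k +ℚ 1ℚ
ι-suc k = /-suc k 0

ι-+ : ∀ j k → ι (j + k) ≡ ι j +ℚ ι k
ι-+ zero    k = sym (ℚ.+-identityˡ (ι k))
ι-+ (suc j) k = begin
  ι (suc (j + k))         ≡⟨ ι-suc (j + k) ⟩
  ι (j + k) +ℚ 1ℚ         ≡⟨ cong (_+ℚ 1ℚ) (ι-+ j k) ⟩
  ι j +ℚ ι k +ℚ 1ℚ        ≡⟨ solve 2 (λ a b → a :+ b :+ con 1ℚ := a :+ con 1ℚ :+ b) refl (ι j) (ι k) ⟩
  ι j +ℚ 1ℚ +ℚ ι k        ≡⟨ cong (_+ℚ ι k) (ι-suc j) ⟨
  ι (suc j) +ℚ ι k        ∎
  where open ≡-Reasoning; open +-*-Solver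

ι-* : ∀ j k → ι (j * k) ≡ ι j *ℚ ι k
ι-* zero    k = sym (ℚ.*-zeroˡ (ι k))
ι-* (suc j) k = begin
  ι (k + j * k)          ≡⟨ ι-+ k (j * k) ⟩
  ι k +ℚ ι (j * k)       ≡⟨ cong (ι k +ℚ_) (ι-* j k) ⟩
  ι k +ℚ ι j *ℚ ι k      ≡⟨ solve 2 (λ a b → b :+ a :* b := (a :+ con 1ℚ) :* b) refl (ι j) (ι k) ⟩
  (ι j +ℚ 1ℚ) *ℚ ι k     ≡⟨ cong (_*ℚ ι k) (ι-suc j) ⟨
  ι (suc j) *ℚ ι k       ∎
  where open ≡-Reasoning; open +-*-Solver

ι-mono-≤ : ∀ {j k} → j ≤ k → ι j ≤ℚ ι k
ι-mono-≤ {j} {k} j≤k = /-mono j k 0 0 (ℕ.*-monoˡ-≤ 1 j≤k)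

ι-nonNeg : ∀ k → ℚ.NonNegative (ι k)
ι-nonNeg k = ℚ.nonNegative (ι-mono-≤ {0} {k} z≤n)

ι-<-suc : ∀ k → ι k <ℚ ι (suc k)
ι-<-suc k = subst₂ _<ℚ_ (ℚ.+-identityʳ (ι k)) (sym (ι-suc k)) (ℚ.+-monoʳ-< (ι k) (ℚ.positive⁻¹ 1ℚ))

ι-cancel-≤ : ∀ {j k} → ι j ≤ℚ ι k → j ≤ k
ι-cancel-≤ {j} {k} ιj≤ιk = ℕ.≮⇒≥ λ k<j →
  ℚ.<-irrefl refl (ℚ.<-≤-trans (ι-<-suc k) (ℚ.≤-trans (ι-mono-≤ k<j) ιj≤ιk))

ι-positive : ∀ k → .{{NonZero k}} → ℚ.Positive (ι k)
ι-positive (suc k) = ℚ.positive (ℚ.≤-<-trans (ι-mono-≤ {0} {k} z≤n) (ι-<-suc k))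

∣ι∣ : ∀ k → ∣ ι k ∣ ≡ ι k
∣ι∣ k = ℚ.0≤p⇒∣p∣≡p (ι-mono-≤ {0} {k} z≤n)

Δ : (ℕ → ℚ) → ℕ → ℚ
Δ u i = u (suc i) -ℚ u i

difference : ℕ → (ℕ → ℚ) → ℚ
difference zero    u = u 0
difference (suc N) u = difference N (Δ u)

difference-Δ : ∀ N u → difference N (Δ u) ≡ difference N (u ∘ suc) -ℚ difference N u
difference-Δ zero    u = refl
difference-Δ (suc N) u = difference-Δ N (Δ u)

-- Annihilated N u: u is a polynomial sequence of degree below N.
data Annihilated : ℕ → (ℕ → ℚ) → Set where
  vanishing : ∀ {u} → (∀ i → u i ≡ 0ℚ) → Annihilated zero u
  step      : ∀ {N u} → Annihilated N (Δ u) → Annihilated (suc N) u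

annihilated⇒difference≡0 : ∀ {N u} → Annihilated N u → difference N u ≡ 0ℚ
annihilated⇒difference≡0 (vanishing u≗0) = u≗0 0
annihilated⇒difference≡0 (step a)        = annihilated⇒difference≡0 a

annihilated-cong : ∀ {N u v} → (∀ i → u i ≡ v i) → Annihilated N u → Annihilated N v
annihilated-cong u≗v (vanishing u≗0) = vanishing (λ i → trans (sym (u≗v i)) (u≗0 i))
annihilated-cong u≗v (step a) = step (annihilated-cong (λ i → cong₂ _-ℚ_ (u≗v (suc i)) (u≗v i)) a)

annihilated-0 : ∀ N → Annihilated N (λ _ → 0ℚ)
annihilated-0 zero    = vanishing (λ _ → refl)
annihilated-0 (suc N) = step (annihilated-0 N)

annihilated-+ : ∀ {N u v} → Annihilated N u → Annihilated N v → Annihilated N (λ i → u i +ℚ v i)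
annihilated-+ (vanishing u≗0) (vanishing v≗0) = vanishing (λ i → cong₂ _+ℚ_ (u≗0 i) (v≗0 i))
annihilated-+ {u = u} {v} (step a) (step b) = step (annihilated-cong
  (λ i → solve 4 (λ p q r s → (p :- q) :+ (r :- s) := (p :+ r) :- (q :+ s)) refl
    (u (suc i)) (u i) (v (suc i)) (v i))
  (annihilated-+ a b))
  where open +-*-Solver

annihilated-shift : ∀ {N u} → Annihilated N u → Annihilated N (u ∘ suc)
annihilated-shift (vanishing u≗0) = vanishing (u≗0 ∘ suc)
annihilated-shift (step a)        = step (annihilated-shift a)

annihilated-const : ∀ {N} p → Annihilated (suc N) (λ _ → p)
annihilated-const p = step (annihilated-cong (λ _ → sym (ℚ.+-inverseʳ p)) (annihilated-0 _))

annihilated-scale : ∀ {N u} p → Annihilated N u → Annihilated N (λ i → p *ℚ u i)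
annihilated-scale p (vanishing u≗0) = vanishing (λ i → trans (cong (p *ℚ_) (u≗0 i)) (ℚ.*-zeroʳ p))
annihilated-scale {u = u} p (step a) = step (annihilated-cong
  (λ i → solve 3 (λ p q r → p :* (q :- r) := p :* q :- p :* r) refl p (u (suc i)) (u i))
  (annihilated-scale p a))
  where open +-*-Solver

module _ (x : ℕ → ℚ) (x-suc : ∀ i → x (suc i) ≡ x i +ℚ 1ℚ) where

  -- Discrete product rule: Δ(x u)(i) = x(i) Δu(i) + u(i+1), since Δx = 1.
  annihilated-* : ∀ {N u} → Annihilated N u → Annihilated (suc N) (λ i → x i *ℚ u i)
  annihilated-* (vanishing u≗0) = step (vanishing (λ i → cong₂ _-ℚ_
    (trans (cong (x (suc i) *ℚ_) (u≗0 (suc i))) (ℚ.*-zeroʳ (x (suc i))))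
    (trans (cong (x i *ℚ_) (u≗0 i)) (ℚ.*-zeroʳ (x i)))))
  annihilated-* {u = u} (step a) = step (annihilated-cong
    (λ i → sym (trans (cong (λ t → t *ℚ u (suc i) -ℚ x i *ℚ u i) (x-suc i))
      (solve 3 (λ p q r → (p :+ con 1ℚ) :* q :- p :* r := p :* (q :- r) :+ q) refl
        (x i) (u (suc i)) (u i))))
    (annihilated-+ (annihilated-* a) (annihilated-shift (step {u = u} a))))
    where open +-*-Solver

horner : ∀ {m} → Vec ℚ m → ℚ → ℚ
horner []      t = 0ℚ
horner (a ∷ c) t = a +ℚ t *ℚ horner c t

-- Every Horner step multiplies by p x², which raises the degree by two.
annihilated-horner : ∀ {m} (x : ℕ → ℚ) → (∀ i → x (suc i) ≡ x i +ℚ 1ℚ) → ∀ p (c : Vec ℚ m) →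
                     Annihilated (m + m) (λ i → horner c (p *ℚ (x i *ℚ x i)))
annihilated-horner x x-suc p [] = vanishing (λ _ → refl)
annihilated-horner {suc m} x x-suc p (a ∷ c) = subst
  (λ N → Annihilated (suc N) (λ i → horner (a ∷ c) (p *ℚ (x i *ℚ x i)))) (sym (ℕ.+-suc m m))
  (annihilated-+ (annihilated-const a) (annihilated-cong
    (λ i → solve 3 (λ p x h → x :* (x :* (p :* h)) := p :* (x :* x) :* h) refl p (x i) (h i))
    (annihilated-* x x-suc (annihilated-* x x-suc
      (annihilated-scale p (annihilated-horner x x-suc p c))))))
  where
  open +-*-Solver
  h : ℕ → ℚ
  h i = horner c (p *ℚ (x i *ℚ x i))

sign : ℕ → ℚ
sign zero    = 1ℚ
sign (suc i) = -ℚ sign i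

∣sign∣ : ∀ i → ∣ sign i ∣ ≡ 1ℚ
∣sign∣ zero    = refl
∣sign∣ (suc i) = trans (ℚ.∣-p∣≡∣p∣ (sign i)) (∣sign∣ i)

-- The coefficient of u(i) in the `N`-th difference. The exponent `N + i` has the parity of N - i
-- and avoids truncated subtraction.
weight : ℕ → ℕ → ℚ
weight N i = sign (N + i) *ℚ ι (N choose i)

weight-zero : ∀ N → weight (suc N) 0 ≡ -ℚ weight N 0
weight-zero N = sym (ℚ.neg-distribˡ-* (sign (N + 0)) 1ℚ)

-- Pascal's rule with signs.
weight-suc : ∀ N i → weight (suc N) (suc i) ≡ weight N i -ℚ weight N (suc i)
weight-suc N i = begin
  -ℚ sign (N + suc i) *ℚ ι (suc N choose suc i)
    ≡⟨ cong₂ (λ k c → -ℚ sign k *ℚ ι c) (ℕ.+-suc N i) (sym (nCk+nC[k+1]≡[n+1]C[k+1] N i)) ⟩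
  -ℚ (-ℚ s) *ℚ ι (N choose i + N choose suc i)
    ≡⟨ cong (-ℚ (-ℚ s) *ℚ_) (ι-+ (N choose i) (N choose suc i)) ⟩
  -ℚ (-ℚ s) *ℚ (ι (N choose i) +ℚ ι (N choose suc i))
    ≡⟨ solve 3 (λ s a b → :- (:- s) :* (a :+ b) := s :* a :- (:- s) :* b) refl s (ι (N choose i)) (ι (N choose suc i)) ⟩
  s *ℚ ι (N choose i) -ℚ -ℚ s *ℚ ι (N choose suc i)
    ≡⟨ cong (λ k → s *ℚ ι (N choose i) -ℚ sign k *ℚ ι (N choose suc i)) (ℕ.+-suc N i) ⟨
  weight N i -ℚ weight N (suc i) ∎
  where
  open ≡-Reasoning
  open +-*-Solver
  s = sign (N + i)

∣p-q∣≤ : ∀ {p q a b} → ∣ p ∣ ≤ℚ a → ∣ q ∣ ≤ℚ b → ∣ p -ℚ q ∣ ≤ℚ a +ℚ b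
∣p-q∣≤ {p} {q} p≤a q≤b = ℚ.≤-trans (ℚ.∣p-q∣≤∣p∣+∣q∣ p q) (ℚ.+-mono-≤ p≤a q≤b)

module _ (b : ℚ) where

  private
    double : ∀ N → ι (2 ^ N) *ℚ b +ℚ ι (2 ^ N) *ℚ b ≡ ι (2 ^ suc N) *ℚ b
    double N = trans (sym (ℚ.*-distribʳ-+ b (ι (2 ^ N)) (ι (2 ^ N))))
      (cong (_*ℚ b) (trans (sym (ι-+ (2 ^ N) (2 ^ N)))
        (cong (λ k → ι (2 ^ N + k)) (sym (ℕ.+-identityʳ (2 ^ N))))))

  ∣difference∣≤ : ∀ N u → (∀ i → i ≤ N → ∣ u i ∣ ≤ℚ b) → ∣ difference N u ∣ ≤ℚ ι (2 ^ N) *ℚ b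
  ∣difference∣≤ zero    u u≤b = subst (∣ u 0 ∣ ≤ℚ_) (sym (ℚ.*-identityˡ b)) (u≤b 0 z≤n)
  ∣difference∣≤ (suc N) u u≤b = subst₂ _≤ℚ_
    (cong ∣_∣ (sym (difference-Δ N u))) (double N)
    (∣p-q∣≤ {difference N (u ∘ suc)} {difference N u} (∣difference∣≤ N (u ∘ suc) (λ i i≤N → u≤b (suc i) (s≤s i≤N)))
            (∣difference∣≤ N u (λ i i≤N → u≤b i (ℕ.m≤n⇒m≤1+n i≤N))))

  -- The term at `c` is split off because its value is the unknown to be estimated, so only the
  -- other values need a bound. The absolute weights add up to at most 2ᴺ.
  ∣difference-weight∣≤ : 0ℚ ≤ℚ b → ∀ N c u → (∀ i → i ≤ N → i ≢ c → ∣ u i ∣ ≤ℚ b) →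
    ∣ difference N u -ℚ weight N c *ℚ u c ∣ ≤ℚ ι (2 ^ N) *ℚ b
  ∣difference-weight∣≤ b≥0 zero zero u u≤b = subst₂ _≤ℚ_
    (cong ∣_∣ (sym (trans (cong (λ t → u 0 -ℚ t) (ℚ.*-identityˡ (u 0))) (ℚ.+-inverseʳ (u 0)))))
    (sym (ℚ.*-identityˡ b)) b≥0
  ∣difference-weight∣≤ b≥0 zero (suc c) u u≤b = subst₂ _≤ℚ_
    (cong ∣_∣ (sym (trans (cong (λ t → u 0 -ℚ t *ℚ u (suc c)) (ℚ.*-zeroʳ (sign (suc c))))
      (trans (cong (λ t → u 0 -ℚ t) (ℚ.*-zeroˡ (u (suc c)))) (ℚ.+-identityʳ (u 0))))))
    (sym (ℚ.*-identityˡ b)) (u≤b 0 z≤n λ ())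
  ∣difference-weight∣≤ b≥0 (suc N) zero u u≤b = subst₂ _≤ℚ_
    (cong ∣_∣ (sym (begin
      difference (suc N) u -ℚ weight (suc N) 0 *ℚ u 0
        ≡⟨ cong₂ (λ d w → d -ℚ w *ℚ u 0) (difference-Δ N u) (weight-zero N) ⟩
      (difference N (u ∘ suc) -ℚ difference N u) -ℚ -ℚ weight N 0 *ℚ u 0
        ≡⟨ solve 4 (λ d e w v → (d :- e) :- (:- w) :* v := d :- (e :- w :* v)) refl
             (difference N (u ∘ suc)) (difference N u) (weight N 0) (u 0) ⟩
      difference N (u ∘ suc) -ℚ (difference N u -ℚ weight N 0 *ℚ u 0) ∎)))
    (double N)
    (∣p-q∣≤ {difference N (u ∘ suc)} {difference N u -ℚ weight N 0 *ℚ u 0}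
      (∣difference∣≤ N (u ∘ suc) (λ i i≤N → u≤b (suc i) (s≤s i≤N) λ ()))
      (∣difference-weight∣≤ b≥0 N zero u (λ i i≤N → u≤b i (ℕ.m≤n⇒m≤1+n i≤N))))
    where
    open ≡-Reasoning
    open +-*-Solver
  ∣difference-weight∣≤ b≥0 (suc N) (suc c) u u≤b = subst₂ _≤ℚ_
    (cong ∣_∣ (sym (begin
      difference (suc N) u -ℚ weight (suc N) (suc c) *ℚ u (suc c)
        ≡⟨ cong₂ (λ d w → d -ℚ w *ℚ u (suc c)) (difference-Δ N u) (weight-suc N c) ⟩
      (difference N (u ∘ suc) -ℚ difference N u) -ℚ (weight N c -ℚ weight N (suc c)) *ℚ u (suc c)
        ≡⟨ solve 5 (λ d e w x v → (d :- e) :- (w :- x) :* v := (d :- w :* v) :- (e :- x :* v)) refl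
             (difference N (u ∘ suc)) (difference N u) (weight N c) (weight N (suc c)) (u (suc c)) ⟩
      (difference N (u ∘ suc) -ℚ weight N c *ℚ u (suc c)) -ℚ
      (difference N u -ℚ weight N (suc c) *ℚ u (suc c)) ∎)))
    (double N)
    (∣p-q∣≤ {difference N (u ∘ suc) -ℚ weight N c *ℚ u (suc c)}
            {difference N u -ℚ weight N (suc c) *ℚ u (suc c)}
      (∣difference-weight∣≤ b≥0 N c (u ∘ suc) (λ i i≤N i≢c → u≤b (suc i) (s≤s i≤N) (i≢c ∘ ℕ.suc-injective)))
      (∣difference-weight∣≤ b≥0 N (suc c) u (λ i i≤N → u≤b i (ℕ.m≤n⇒m≤1+n i≤N))))
    where
    open ≡-Reasoning
    open +-*-Solver

-- The central binomial coefficient and interpolation at squares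

C*k![n∸k]!≡n! : ∀ {n k} → k ≤ n → (n choose k) * (k ! * (n ∸ k) !) ≡ n !
C*k![n∸k]!≡n! {n} {k} k≤n = trans (cong (_* (k ! * (n ∸ k) !)) (nCk≡n!/k![n-k]! k≤n))
  (ℕ.m/n*n≡m {{k !* (n ∸ k) !≢0}} (k![n∸k]!∣n! k≤n))

-- The lower bound 4ᵏ / 2k on the central binomial coefficient, cleared of denominators, for k = m +
-- 1; it fails at k = 0. The induction step comes down to 2k ≤ 2k + 1.
4^m*m!m!≤ : ∀ m → 4 ^ suc m * (suc m ! * suc m !) ≤ 2 * suc m * (suc m + suc m) !
4^m*m!m!≤ zero = ℕ.≤-refl
4^m*m!m!≤ (suc m) = begin
  4 ^ suc k * (suc k ! * suc k !)                ≡⟨ lhs (4 ^ k) k (k !) ⟩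
  4 * (suc k * suc k) * (4 ^ k * (k ! * k !))    ≤⟨ ℕ.*-monoʳ-≤ (4 * (suc k * suc k)) (4^m*m!m!≤ m) ⟩
  4 * (suc k * suc k) * (2 * k * (k + k) !)      ≤⟨ ℕ.*-monoʳ-≤ (4 * (suc k * suc k)) (ℕ.*-monoˡ-≤ ((k + k) !) 2k≤) ⟩
  4 * (suc k * suc k) * (suc (k + k) * (k + k) !) ≡⟨ rhs k ((k + k) !) ⟩
  2 * suc k * (suc (suc (k + k)) * (suc (k + k) * (k + k) !))
                                                 ≡⟨ cong (λ j → 2 * suc k * suc j !) (sym (ℕ.+-suc k k)) ⟩
  2 * suc k * (suc k + suc k) !                  ∎
  where
  open ℕ.≤-Reasoning
  k = suc m
  2k≤ : 2 * k ≤ suc (k + k)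
  2k≤ = ℕ.m≤n⇒m≤1+n (ℕ.≤-reflexive (cong (k +_) (ℕ.+-identityʳ k)))
  lhs : ∀ p k q → 4 * p * ((suc k * q) * (suc k * q)) ≡ 4 * (suc k * suc k) * (p * (q * q))
  lhs = solve-∀
  rhs : ∀ k q → 4 * (suc k * suc k) * (suc (k + k) * q) ≡
                2 * suc k * (suc (suc (k + k)) * (suc (k + k) * q))
  rhs = solve-∀

4^k≤2kC : ∀ k → .{{NonZero k}} → 4 ^ k ≤ 2 * k * ((k + k) choose k)
4^k≤2kC k@(suc m) = ℕ.*-cancelʳ-≤ _ _ (k ! * k !) {{ℕ.m*n≢0 (k !) (k !) {{k!≢0}} {{k!≢0}}}} (begin
  4 ^ k * (k ! * k !)                        ≤⟨ 4^m*m!m!≤ m ⟩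
  2 * k * (k + k) !                          ≡⟨ cong (2 * k *_) (sym (C*k![n∸k]!≡n! (ℕ.m≤m+n k k))) ⟩
  2 * k * (((k + k) choose k) * (k ! * (k + k ∸ k) !))
                                             ≡⟨ cong (λ j → 2 * k * (((k + k) choose k) * (k ! * j !))) (ℕ.m+n∸m≡n k k) ⟩
  2 * k * (((k + k) choose k) * (k ! * k !))        ≡⟨ sym (ℕ.*-assoc (2 * k) ((k + k) choose k) (k ! * k !)) ⟩
  2 * k * ((k + k) choose k) * (k ! * k !)        ∎)
  where
  open ℕ.≤-Reasoning
  k!≢0 = k !≢0

-- Interpolation at the nodes (j/k)², j = 1, …, k: as j ↦ h((j/k)²) is an even polynomial of
-- degree below 2k, its 2k-th difference over -k, …, k vanishes, and the central binomial
-- coefficient is at least 4ᵏ / 2k.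
∣horner-0∣≤ : ∀ {k} → .{{NonZero k}} → (h : Vec ℚ k) →
  (∀ t → 0ℚ ≤ℚ t → t ≤ℚ 1ℚ → ∣ t *ℚ horner h t ∣ ≤ℚ 1ℚ) →
  ∣ horner h 0ℚ ∣ ≤ℚ ι (2 * k * (k * k))
∣horner-0∣≤ {k} h bounded = ℚ.*-cancelˡ-≤-pos (ι B) (begin
  ι B *ℚ ∣ horner h 0ℚ ∣              ≡⟨ cong₂ _*ℚ_ (sym ∣w∣) (cong ∣_∣ (sym centre)) ⟩
  ∣ w ∣ *ℚ ∣ u k ∣                    ≡⟨ ℚ.∣p*q∣≡∣p∣*∣q∣ w (u k) ⟨
  ∣ w *ℚ u k ∣                        ≡⟨ ℚ.∣-p∣≡∣p∣ (w *ℚ u k) ⟨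
  ∣ -ℚ (w *ℚ u k) ∣                   ≡⟨ cong ∣_∣ (sym (ℚ.+-identityˡ (-ℚ (w *ℚ u k)))) ⟩
  ∣ 0ℚ -ℚ w *ℚ u k ∣                  ≡⟨ cong (λ d → ∣ d -ℚ w *ℚ u k ∣) difference≡0 ⟨
  ∣ difference (k + k) u -ℚ w *ℚ u k ∣ ≤⟨ ∣difference-weight∣≤ (ι K) (ι-mono-≤ {0} {K} z≤n) (k + k) k u nodes ⟩
  ι (2 ^ (k + k)) *ℚ ι K              ≡⟨ ι-* (2 ^ (k + k)) K ⟨
  ι (2 ^ (k + k) * K)                 ≤⟨ ι-mono-≤ (ℕ.*-monoˡ-≤ K 2^2k≤) ⟩
  ι (2 * k * B * K)                   ≡⟨ cong ι (rearrange (2 * k) B K) ⟩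
  ι (B * (2 * k * K))                 ≡⟨ ι-* B (2 * k * K) ⟩
  ι B *ℚ ι (2 * k * K)                ∎)
  where
  open ℚ.≤-Reasoning
  K = k * k
  B = (k + k) choose k
  w = weight (k + k) k
  rearrange : ∀ a b c → a * b * c ≡ b * (a * c)
  rearrange = solve-∀
  2^2k≤ : 2 ^ (k + k) ≤ 2 * k * B
  2^2k≤ = subst (_≤ 2 * k * B)
    (trans (ℕ.^-*-assoc 2 2 k) (cong (λ e → 2 ^ (k + e)) (ℕ.+-identityʳ k))) (4^k≤2kC k)
  instance
    B≢0 : NonZero B
    B≢0 = ℕ.m*n≢0⇒n≢0 (2 * k) {B} {{>-nonZero (ℕ.<-≤-trans (ℕ.m^n>0 2 (k + k)) 2^2k≤)}}
    B-pos : ℚ.Positive (ι B)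
    B-pos = ι-positive B
    K≢0 : NonZero K
    K≢0 = ℕ.m*n≢0 k k
    K-pos : ℚ.Positive (ι K)
    K-pos = ι-positive K
    K-nonZero : ℚ.NonZero (ι K)
    K-nonZero = ℚ.pos⇒nonZero (ι K)
  μ : ℚ
  μ = 1/ ι K
  instance
    μ-pos : ℚ.Positive μ
    μ-pos = ℚ.1/pos⇒pos (ι K)
    μ-nonNeg : ℚ.NonNegative μ
    μ-nonNeg = ℚ.pos⇒nonNeg μ
  μK≡1 : μ *ℚ ι K ≡ 1ℚ
  μK≡1 = ℚ.*-inverseˡ (ι K)
  x : ℕ → ℚ
  x i = ι i -ℚ ι k
  x-suc : ∀ i → x (suc i) ≡ x i +ℚ 1ℚ
  x-suc i = trans (cong (_+ℚ -ℚ ι k) (ι-suc i))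
    (solve 2 (λ a b → a :+ con 1ℚ :+ :- b := a :- b :+ con 1ℚ) refl (ι i) (ι k))
    where open +-*-Solver
  u : ℕ → ℚ
  u i = horner h (μ *ℚ (x i *ℚ x i))
  difference≡0 : difference (k + k) u ≡ 0ℚ
  difference≡0 = annihilated⇒difference≡0 (annihilated-horner x x-suc μ h)
  ∣w∣ : ∣ w ∣ ≡ ι B
  ∣w∣ = trans (ℚ.∣p*q∣≡∣p∣*∣q∣ (sign (k + k + k)) (ι B))
    (trans (cong₂ _*ℚ_ (∣sign∣ (k + k + k)) (∣ι∣ B)) (ℚ.*-identityˡ (ι B)))
  centre : u k ≡ horner h 0ℚ
  centre = cong (horner h) (trans (cong (λ t → μ *ℚ (t *ℚ t)) (ℚ.+-inverseʳ (ι k))) (ℚ.*-zeroʳ μ))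
  -- Index `i` stands for i - k, so the two halves of 0, ..., 2k fold onto the nodes j = 1, ..., k.
  square : ∀ i → i ≤ k + k → i ≢ k → ∃[ j ] 1 ≤ j × j ≤ k × x i *ℚ x i ≡ ι (j * j)
  square i i≤2k i≢k with ℕ.≤-total i k
  ... | inj₁ i≤k = k ∸ i , ℕ.m<n⇒0<n∸m (ℕ.≤∧≢⇒< i≤k i≢k) , ℕ.m∸n≤m k i
    , trans (cong (λ t → t *ℚ t) (trans (cong (λ n → ι i -ℚ ι n) (sym (ℕ.m+[n∸m]≡n i≤k)))
        (cong (λ t → ι i -ℚ t) (ι-+ i (k ∸ i)))))
      (trans (solve 2 (λ a b → (a :- (a :+ b)) :* (a :- (a :+ b)) := b :* b) refl (ι i) (ι (k ∸ i)))
        (sym (ι-* (k ∸ i) (k ∸ i))))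
    where open +-*-Solver
  ... | inj₂ k≤i = i ∸ k , ℕ.m<n⇒0<n∸m (ℕ.≤∧≢⇒< k≤i (i≢k ∘ sym)) , ℕ.m≤n+o⇒m∸n≤o i k i≤2k
    , trans (cong (λ t → t *ℚ t) (trans (cong (λ n → ι n -ℚ ι k) (sym (ℕ.m+[n∸m]≡n k≤i)))
        (cong (λ t → t -ℚ ι k) (ι-+ k (i ∸ k)))))
      (trans (solve 2 (λ a b → ((a :+ b) :- a) :* ((a :+ b) :- a) := b :* b) refl (ι k) (ι (i ∸ k)))
        (sym (ι-* (i ∸ k) (i ∸ k))))
    where open +-*-Solver
  -- Away from the centre t = j²/k² is at least 1/k², so the bound 1 on t h(t) gives the bound k² on
  -- h(t).
  nodes : ∀ i → i ≤ k + k → i ≢ k → ∣ u i ∣ ≤ℚ ι K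
  nodes i i≤2k i≢k with square i i≤2k i≢k
  ... | j , 1≤j , j≤k , eq = ℚ.*-cancelˡ-≤-pos μ (begin
    μ *ℚ ∣ u i ∣            ≤⟨ ℚ.*-monoʳ-≤-nonNeg ∣ u i ∣ {{ℚ.∣-∣-nonNeg (u i)}} μ≤t ⟩
    t *ℚ ∣ u i ∣            ≡⟨ cong (_*ℚ ∣ u i ∣) (sym (ℚ.0≤p⇒∣p∣≡p 0≤t)) ⟩
    ∣ t ∣ *ℚ ∣ u i ∣        ≡⟨ ℚ.∣p*q∣≡∣p∣*∣q∣ t (u i) ⟨
    ∣ t *ℚ u i ∣            ≤⟨ bounded t 0≤t t≤1 ⟩
    1ℚ                      ≡⟨ μK≡1 ⟨
    μ *ℚ ι K                ∎)
    where
    t = μ *ℚ (x i *ℚ x i)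
    t≡ : t ≡ μ *ℚ ι (j * j)
    t≡ = cong (μ *ℚ_) eq
    μ≤t : μ ≤ℚ t
    μ≤t = subst₂ _≤ℚ_ (ℚ.*-identityʳ μ) (sym t≡)
      (ℚ.*-monoˡ-≤-nonNeg μ (ι-mono-≤ {1} {j * j} (ℕ.*-mono-≤ 1≤j 1≤j)))
    0≤t : 0ℚ ≤ℚ t
    0≤t = ℚ.≤-trans (ℚ.nonNegative⁻¹ μ) μ≤t
    t≤1 : t ≤ℚ 1ℚ
    t≤1 = subst₂ _≤ℚ_ (sym t≡) μK≡1 (ℚ.*-monoˡ-≤-nonNeg μ (ι-mono-≤ (ℕ.*-mono-≤ j≤k j≤k)))

-- Sensitive blocks and the degree

contains : Subset n → Cube n → Bool
contains []          []      = true
contains (false ∷ T) (_ ∷ z) = contains T z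
contains (true ∷ T)  (b ∷ z) = b ∧ contains T z

monomial : Subset n → Cube n → ℚ
monomial T z = toℚ (contains T z)

-- Degree below `d`, generated from monomials, so that statements linear in the function reduce to
-- monomials; `ext` stands in for function extensionality.
data LowDegree {n} (d : ℕ) : (Cube n → ℚ) → Set where
  mono : ∀ T → ∥ T ∥ < d → LowDegree d (monomial T)
  zer  : LowDegree d (λ _ → 0ℚ)
  add  : ∀ {g h} → LowDegree d g → LowDegree d h → LowDegree d (λ z → g z +ℚ h z)
  mul  : ∀ {g} p → LowDegree d g → LowDegree d (λ z → p *ℚ g z)
  ext  : ∀ {g h} → (∀ z → g z ≡ h z) → LowDegree d g → LowDegree d h

lowDegree-tail : ∀ {d} {g : Cube n → ℚ} → LowDegree d g → LowDegree d (g ∘ tail)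
lowDegree-tail (mono T T<d)  = ext (λ { (_ ∷ _) → refl }) (mono (false ∷ T) T<d)
lowDegree-tail zer           = zer
lowDegree-tail (add l l′)    = add (lowDegree-tail l) (lowDegree-tail l′)
lowDegree-tail (mul p l)     = mul p (lowDegree-tail l)
lowDegree-tail (ext g≗h l)   = ext (g≗h ∘ tail) (lowDegree-tail l)

lowDegree-head : ∀ {d} {g : Cube n → ℚ} → LowDegree (pred d) g →
                 LowDegree d (λ z → toℚ (head z) *ℚ g (tail z))
lowDegree-head {d = suc d} (mono T T<d) = ext eq (mono (true ∷ T) (s≤s T<d))
  where
  eq : ∀ z → monomial (true ∷ T) z ≡ toℚ (head z) *ℚ monomial T (tail z)
  eq (false ∷ z) = sym (ℚ.*-zeroˡ (monomial T z))
  eq (true ∷ z)  = sym (ℚ.*-identityˡ (monomial T z))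
lowDegree-head zer = ext (λ z → sym (ℚ.*-zeroʳ (toℚ (head z)))) zer
lowDegree-head (add {g} {h} l l′) =
  ext (λ z → sym (ℚ.*-distribˡ-+ (toℚ (head z)) (g (tail z)) (h (tail z))))
    (add (lowDegree-head l) (lowDegree-head l′))
lowDegree-head (mul {g} p l) =
  ext (λ z → solve 3 (λ p b q → p :* (b :* q) := b :* (p :* q)) refl p (toℚ (head z)) (g (tail z)))
    (mul p (lowDegree-head l))
  where open +-*-Solver
lowDegree-head (ext g≗h l) = ext (λ z → cong (toℚ (head z) *ℚ_) (g≗h (tail z))) (lowDegree-head l)

alternating-- : ∀ (T : Subset n) g h →
                alternating T (λ S → g S -ℚ h S) ≡ alternating T g -ℚ alternating T h
alternating-- []          g h = refl
alternating-- (false ∷ T) g h = alternating-- T (g ∘ (false ∷_)) (h ∘ (false ∷_))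
alternating-- (true ∷ T)  g h = trans
  (cong₂ _-ℚ_ (alternating-- T (g ∘ (true ∷_)) (h ∘ (true ∷_)))
              (alternating-- T (g ∘ (false ∷_)) (h ∘ (false ∷_))))
  (solve 4 (λ a b c d → (a :- b) :- (c :- d) := (a :- c) :- (b :- d)) refl
    (alternating T (g ∘ (true ∷_))) (alternating T (h ∘ (true ∷_)))
    (alternating T (g ∘ (false ∷_))) (alternating T (h ∘ (false ∷_))))
  where open +-*-Solver

-- Write g = g₀ + z₀ (g₁ - g₀). The coefficients of g₁ - g₀ are those of g at sets containing the
-- first coordinate, and the factor z₀ accounts for the `pred d`.
lowDegree : ∀ d (g : Cube n → ℚ) → (∀ T → d ≤ ∥ T ∥ → alternating T g ≡ 0ℚ) → LowDegree d g
lowDegree {zero} zero g high = ext (λ { [] → sym (high [] z≤n) }) zer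
lowDegree {zero} (suc d) g high =
  ext (λ { [] → ℚ.*-identityʳ (g []) }) (mul (g []) (mono [] (s≤s z≤n)))
lowDegree {suc n} d g high = ext expand
  (add (lowDegree-tail (lowDegree d g₀ λ T → high (false ∷ T)))
       (lowDegree-head (lowDegree (pred d) (λ z → g₁ z -ℚ g₀ z) λ T d≤T →
         trans (alternating-- T g₁ g₀) (high (true ∷ T) (pred-≤ d d≤T)))))
  where
  g₀ = g ∘ (false ∷_)
  g₁ = g ∘ (true ∷_)
  pred-≤ : ∀ {k} d → pred d ≤ k → d ≤ suc k
  pred-≤ zero    _  = z≤n
  pred-≤ (suc d) le = s≤s le
  open +-*-Solver
  expand : ∀ z → g₀ (tail z) +ℚ toℚ (head z) *ℚ (g₁ (tail z) -ℚ g₀ (tail z)) ≡ g z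
  expand (false ∷ z) = solve 2 (λ a b → b :+ con 0ℚ :* (a :- b) := b) refl (g₁ z) (g₀ z)
  expand (true ∷ z)  = solve 2 (λ a b → b :+ con 1ℚ :* (a :- b) := a) refl (g₁ z) (g₀ z)

-- The expected value of g at z with each of the blocks toggled independently with probability t.
expectation : ℚ → List (Subset n) → (Cube n → ℚ) → Cube n → ℚ
expectation t []       g z = g z
expectation t (B ∷ Bs) g z = (1ℚ -ℚ t) *ℚ expectation t Bs g z +ℚ t *ℚ expectation t Bs g (z ⊕ B)

-- The derivative of the expectation at t = 0.
increments : List (Subset n) → (Cube n → ℚ) → Cube n → ℚ
increments []       g z = 0ℚ
increments (B ∷ Bs) g z = (g (z ⊕ B) -ℚ g z) +ℚ increments Bs g z

expectation-cong : ∀ t (Bs : List (Subset n)) {g h} → (∀ z → g z ≡ h z) → ∀ z →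
                   expectation t Bs g z ≡ expectation t Bs h z
expectation-cong t []       g≗h z = g≗h z
expectation-cong t (B ∷ Bs) g≗h z = cong₂ (λ p q → (1ℚ -ℚ t) *ℚ p +ℚ t *ℚ q)
  (expectation-cong t Bs g≗h z) (expectation-cong t Bs g≗h (z ⊕ B))

increments-cong : ∀ (Bs : List (Subset n)) {g h} → (∀ z → g z ≡ h z) → ∀ z →
                  increments Bs g z ≡ increments Bs h z
increments-cong []       g≗h z = refl
increments-cong (B ∷ Bs) g≗h z =
  cong₂ _+ℚ_ (cong₂ _-ℚ_ (g≗h (z ⊕ B)) (g≗h z)) (increments-cong Bs g≗h z)

⊕-swap : ∀ (x y z : Cube n) → x ⊕ y ⊕ z ≡ x ⊕ z ⊕ y
⊕-swap x y z = trans (⊕-assoc x y z)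
  (trans (cong (x ⊕_) (Vec.zipWith-comm Bool.xor-comm y z)) (sym (⊕-assoc x z y)))

expectation-shift : ∀ t (Bs : List (Subset n)) g z B →
                    expectation t Bs g (z ⊕ B) ≡ expectation t Bs (λ y → g (y ⊕ B)) z
expectation-shift t []       g z B = refl
expectation-shift t (C ∷ Bs) g z B = cong₂ (λ p q → (1ℚ -ℚ t) *ℚ p +ℚ t *ℚ q)
  (expectation-shift t Bs g z B)
  (trans (cong (expectation t Bs g) (⊕-swap z B C)) (expectation-shift t Bs g (z ⊕ C) B))

Bounded : (Cube n → ℚ) → Set
Bounded g = ∀ z → 0ℚ ≤ℚ g z × g z ≤ℚ 1ℚ

expectation-bounded : ∀ {t} → 0ℚ ≤ℚ t → t ≤ℚ 1ℚ → ∀ (Bs : List (Subset n)) {g} → Bounded g →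
                      Bounded (expectation t Bs g)
expectation-bounded 0≤t t≤1 [] b = b
expectation-bounded {t = t} 0≤t t≤1 (B ∷ Bs) {g} b z =
  let l , l′ = expectation-bounded 0≤t t≤1 Bs b z
      r , r′ = expectation-bounded 0≤t t≤1 Bs b (z ⊕ B)
  in subst (_≤ℚ expectation t (B ∷ Bs) g z) (trans (cong₂ _+ℚ_ (ℚ.*-zeroʳ s) (ℚ.*-zeroʳ t)) refl) (convex l r)
   , subst (expectation t (B ∷ Bs) g z ≤ℚ_) (solve 1 (λ t → (con 1ℚ :- t) :* con 1ℚ :+ t :* con 1ℚ := con 1ℚ) refl t) (convex l′ r′)
  where
  open +-*-Solver
  s = 1ℚ -ℚ t
  instance
    t-nonNeg : ℚ.NonNegative t
    t-nonNeg = ℚ.nonNegative 0≤t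
    s-nonNeg : ℚ.NonNegative s
    s-nonNeg = ℚ.nonNegative (subst (_≤ℚ s) (ℚ.+-inverseʳ t) (ℚ.+-monoˡ-≤ (-ℚ t) t≤1))
  convex : ∀ {p q p′ q′} → p ≤ℚ p′ → q ≤ℚ q′ → s *ℚ p +ℚ t *ℚ q ≤ℚ s *ℚ p′ +ℚ t *ℚ q′
  convex p≤ q≤ = ℚ.+-mono-≤ (ℚ.*-monoˡ-≤-nonNeg s p≤) (ℚ.*-monoˡ-≤-nonNeg t q≤)

-- The expectation is a polynomial in t of degree at most `m` with constant term g(z). Its quotient
-- by t is kept as a coefficient list, because the derivative at 0 is then a plain value.
record Expansion (m : ℕ) (Bs : List (Subset n)) (g : Cube n → ℚ) (z : Cube n) : Set where
  constructor expansion
  field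
    quotient     : Vec ℚ m
    expectation≡ : ∀ t → expectation t Bs g z ≡ g z +ℚ t *ℚ horner quotient t
    increments≡  : horner quotient 0ℚ ≡ increments Bs g z

horner-0s : ∀ m t → horner (replicate m 0ℚ) t ≡ 0ℚ
horner-0s zero    t = refl
horner-0s (suc m) t = trans (cong (λ p → 0ℚ +ℚ t *ℚ p) (horner-0s m t))
  (trans (ℚ.+-identityˡ (t *ℚ 0ℚ)) (ℚ.*-zeroʳ t))

horner-+ : ∀ {m} (a b : Vec ℚ m) t → horner (Vec.zipWith _+ℚ_ a b) t ≡ horner a t +ℚ horner b t
horner-+ []      []      t = refl
horner-+ (p ∷ a) (q ∷ b) t = trans (cong (λ r → p +ℚ q +ℚ t *ℚ r) (horner-+ a b t))
  (solve 5 (λ p q t a b → p :+ q :+ t :* (a :+ b) := (p :+ t :* a) :+ (q :+ t :* b)) refl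
    p q t (horner a t) (horner b t))
  where open +-*-Solver

horner-* : ∀ {m} p (a : Vec ℚ m) t → horner (Vec.map (p *ℚ_) a) t ≡ p *ℚ horner a t
horner-* p []      t = sym (ℚ.*-zeroʳ p)
horner-* p (q ∷ a) t = trans (cong (λ r → p *ℚ q +ℚ t *ℚ r) (horner-* p a t))
  (solve 4 (λ p q t a → p :* q :+ t :* (p :* a) := p :* (q :+ t :* a)) refl p q t (horner a t))
  where open +-*-Solver

contains-miss : ∀ (T : Subset n) {z i} → lookup T i ≡ true → lookup z i ≡ false → contains T z ≡ false
contains-miss (true ∷ T)  {false ∷ z} {zero}  _ _ = refl
contains-miss (false ∷ T) {_ ∷ z}     {suc i} p q = contains-miss T p q
contains-miss (true ∷ T)  {b ∷ z}     {suc i} p q =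
  trans (cong (b ∧_) (contains-miss T p q)) (Bool.∧-zeroʳ b)

contains-cong : ∀ (T : Subset n) {y z} → (∀ i → lookup T i ≡ true → lookup y i ≡ lookup z i) →
                contains T y ≡ contains T z
contains-cong []          {[]}    {[]}    _   = refl
contains-cong (false ∷ T) {_ ∷ y} {_ ∷ z} y≗z = contains-cong T (y≗z ∘ suc)
contains-cong (true ∷ T)  {_ ∷ y} {_ ∷ z} y≗z =
  cong₂ _∧_ (y≗z zero refl) (contains-cong T (y≗z ∘ suc))

module _ (T : Subset n) {i} (i∈T : lookup T i ≡ true) where

  monomial-miss : ∀ z → lookup z i ≡ false → monomial T z ≡ 0ℚ
  monomial-miss z i∉z = cong toℚ (contains-miss T {z} i∈T i∉z)

  private
    miss-⊕ : ∀ z B → lookup z i ≡ false → lookup B i ≡ false → lookup (z ⊕ B) i ≡ false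
    miss-⊕ z B i∉z i∉B = trans (lookup-⊕ z B i) (cong₂ _xor_ i∉z i∉B)

  expectation-miss : ∀ t {Bs} z → lookup z i ≡ false → All (λ B → lookup B i ≡ false) Bs →
                     expectation t Bs (monomial T) z ≡ 0ℚ
  expectation-miss t z i∉z [] = monomial-miss z i∉z
  expectation-miss t {B ∷ _} z i∉z (i∉B ∷ i∉Bs) = trans
    (cong₂ (λ p q → (1ℚ -ℚ t) *ℚ p +ℚ t *ℚ q)
      (expectation-miss t z i∉z i∉Bs) (expectation-miss t (z ⊕ B) (miss-⊕ z B i∉z i∉B) i∉Bs))
    (cong₂ _+ℚ_ (ℚ.*-zeroʳ (1ℚ -ℚ t)) (ℚ.*-zeroʳ t))

  increments-miss : ∀ {Bs} z → lookup z i ≡ false → All (λ B → lookup B i ≡ false) Bs →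
                    increments Bs (monomial T) z ≡ 0ℚ
  increments-miss z i∉z [] = refl
  increments-miss {B ∷ _} z i∉z (i∉B ∷ i∉Bs) = cong₂ _+ℚ_
    (cong₂ _-ℚ_ (monomial-miss (z ⊕ B) (miss-⊕ z B i∉z i∉B)) (monomial-miss z i∉z))
    (increments-miss z i∉z i∉Bs)

disjoint-false : ∀ {B C : Subset n} {i} → Disjoint B C → lookup B i ≡ true → lookup C i ≡ false
disjoint-false {i = i} d i∈B = Bool.¬-not (disjoint⁻ d i i∈B)

disjoint-⊕ : ∀ {z B C : Subset n} → Disjoint z C → Disjoint B C → Disjoint (z ⊕ B) C
disjoint-⊕ {z = z} {B} zC BC = disjoint⁺ λ i i∈z⊕B i∈C → contradiction
  (trans (sym i∈z⊕B) (trans (lookup-⊕ z B i) (cong₂ _xor_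
    (disjoint-false (Disjoint-sym zC) i∈C) (disjoint-false (Disjoint-sym BC) i∈C)))) λ ()

-- Disjointness of `z` and `B` makes the toggle a union: nothing already covered is lost, and `i` is
-- gained.
missing-⊕-< : ∀ {T z B : Subset n} {i} → Disjoint z B → lookup T i ≡ true → lookup B i ≡ true →
              ∥ T ∩ ∁ (z ⊕ B) ∥ < ∥ T ∩ ∁ z ∥
missing-⊕-< {T = T} {z} {B} {i} zB i∈T i∈B = p⊂q⇒∣p∣<∣q∣
  ( (λ {j} j∈ → let j∈T , j∈∁ = x∈p∩q⁻ T (∁ (z ⊕ B)) j∈ in
      x∈p∩q⁺ (j∈T , x∉p⇒x∈∁p λ j∈z → x∈∁p⇒x∉p j∈∁ (lookup⇒[]= j _ (trans (lookup-⊕ z B j)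
        (cong₂ _xor_ ([]=⇒lookup j∈z) (disjoint-false zB ([]=⇒lookup j∈z)))))))
  , i
  , x∈p∩q⁺ (lookup⇒[]= i T i∈T , x∉p⇒x∈∁p λ i∈z → disjoint⁻ zB i ([]=⇒lookup i∈z) i∈B)
  , λ i∈ → x∈∁p⇒x∉p (proj₂ (x∈p∩q⁻ T (∁ (z ⊕ B)) i∈)) (lookup⇒[]= i _ (trans (lookup-⊕ z B i)
      (cong₂ _xor_ (disjoint-false (Disjoint-sym zB) i∈B) i∈B))))

-- A block disjoint from T leaves the expectation unchanged; a block meeting T has to be chosen,
-- which contributes a factor t and leaves fewer coordinates of T uncovered.
expansion-monomial : ∀ m (T : Subset n) Bs {z} → AllPairs Disjoint Bs → All (Disjoint z) Bs →
                     ∥ T ∩ ∁ z ∥ ≤ m → Expansion m Bs (monomial T) z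
expansion-monomial m T [] {z} _ _ _ = expansion (replicate m 0ℚ)
  (λ t → sym (trans (cong (λ p → monomial T z +ℚ t *ℚ p) (horner-0s m t))
    (trans (cong (monomial T z +ℚ_) (ℚ.*-zeroʳ t)) (ℚ.+-identityʳ (monomial T z)))))
  (horner-0s m 0ℚ)
expansion-monomial m T (B ∷ Bs) {z} (dB ∷ dBs) (zB ∷ zBs) le
  with Fin.any? (λ i → (lookup T i Bool.≟ true) ×-dec (lookup B i Bool.≟ true))
expansion-monomial m T (B ∷ Bs) {z} (dB ∷ dBs) (zB ∷ zBs) le | no ∄i
  with expansion-monomial m T Bs dBs zBs le
... | expansion a e≡ i≡ = expansion a
  (λ t → trans (cong (λ p → (1ℚ -ℚ t) *ℚ E t +ℚ t *ℚ p) (trans (expectation-shift t Bs (monomial T) z B)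
      (expectation-cong t Bs unchanged z)))
    (trans (solve 2 (λ t e → (con 1ℚ :- t) :* e :+ t :* e := e) refl t (E t)) (e≡ t)))
  (trans i≡ (sym (trans (cong (λ p → (p -ℚ monomial T z) +ℚ increments Bs (monomial T) z) (unchanged z))
    (trans (cong (_+ℚ increments Bs (monomial T) z) (ℚ.+-inverseʳ (monomial T z))) (ℚ.+-identityˡ _)))))
  where
  open +-*-Solver
  E : ℚ → ℚ
  E t = expectation t Bs (monomial T) z
  unchanged : ∀ y → monomial T (y ⊕ B) ≡ monomial T y
  unchanged y = cong toℚ (contains-cong T λ i i∈T → trans (lookup-⊕ y B i)
    (trans (cong (lookup y i xor_) (Bool.¬-not λ i∈B → ∄i (i , i∈T , i∈B)))
      (Bool.xor-identityʳ (lookup y i))))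
expansion-monomial zero T (B ∷ Bs) {z} (dB ∷ dBs) (zB ∷ zBs) le | yes (i , i∈T , i∈B) =
  contradiction (ℕ.<-≤-trans (missing-⊕-< {T = T} {z} {B} zB i∈T i∈B) le) λ ()
expansion-monomial (suc m) T (B ∷ Bs) {z} (dB ∷ dBs) (zB ∷ zBs) le | yes (i , i∈T , i∈B)
  with expansion-monomial m T Bs {z ⊕ B} dBs
         (All.zipWith (λ (zC , BC) → disjoint-⊕ zC BC) (zBs , dB))
         (ℕ.≤-pred (ℕ.<-≤-trans (missing-⊕-< {T = T} {z} {B} zB i∈T i∈B) le))
-- If `B` is not chosen, `i` stays off for good, as the later blocks are disjoint from `B`, and the
-- monomial is 0. Hence the expectation is t times the one at z ⊕ B, whose constant term becomes the
-- leading entry of the new quotient.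
... | expansion a e≡ i≡ = expansion (monomial T (z ⊕ B) ∷ a)
  (λ t → trans (cong₂ (λ p q → (1ℚ -ℚ t) *ℚ p +ℚ t *ℚ q) (expectation-miss T i∈T t z i∉z i∉Bs) (e≡ t))
    (trans (solve 2 (λ t h → (con 1ℚ :- t) :* con 0ℚ :+ t :* h := con 0ℚ :+ t :* h) refl
        t (monomial T (z ⊕ B) +ℚ t *ℚ horner a t))
      (cong (_+ℚ t *ℚ (monomial T (z ⊕ B) +ℚ t *ℚ horner a t)) (sym (monomial-miss T i∈T z i∉z)))))
  (trans (solve 2 (λ p h → p :+ con 0ℚ :* h := (p :- con 0ℚ) :+ con 0ℚ) refl
      (monomial T (z ⊕ B)) (horner a 0ℚ))
    (cong₂ (λ p q → (monomial T (z ⊕ B) -ℚ p) +ℚ q)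
      (sym (monomial-miss T i∈T z i∉z)) (sym (increments-miss T i∈T z i∉z i∉Bs))))
  where
  open +-*-Solver
  i∉z : lookup z i ≡ false
  i∉z = disjoint-false (Disjoint-sym zB) i∈B
  i∉Bs : All (λ C → lookup C i ≡ false) Bs
  i∉Bs = All.map (λ BC → disjoint-false BC i∈B) dB

expansion-lowDegree : ∀ {m Bs} {g : Cube n → ℚ} {z} → AllPairs Disjoint Bs → All (Disjoint z) Bs →
                      LowDegree (suc m) g → Expansion m Bs g z
expansion-lowDegree {m = m} {Bs} {z = z} dBs zBs (mono T T<) = expansion-monomial m T Bs dBs zBs
  (ℕ.≤-trans (p⊆q⇒∣p∣≤∣q∣ (p∩q⊆p T (∁ z))) (ℕ.≤-pred T<))
expansion-lowDegree {m = m} {Bs} {z = z} dBs zBs zer = expansion (replicate m 0ℚ)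
  (λ t → trans (expectation-0 t Bs z) (sym (trans (ℚ.+-identityˡ _)
    (trans (cong (t *ℚ_) (horner-0s m t)) (ℚ.*-zeroʳ t)))))
  (trans (horner-0s m 0ℚ) (sym (increments-0 Bs)))
  where
  expectation-0 : ∀ t (Bs : List (Subset _)) z → expectation t Bs (λ _ → 0ℚ) z ≡ 0ℚ
  expectation-0 t []       z = refl
  expectation-0 t (B ∷ Bs) z = trans
    (cong₂ (λ p q → (1ℚ -ℚ t) *ℚ p +ℚ t *ℚ q) (expectation-0 t Bs z) (expectation-0 t Bs (z ⊕ B)))
    (cong₂ _+ℚ_ (ℚ.*-zeroʳ (1ℚ -ℚ t)) (ℚ.*-zeroʳ t))
  increments-0 : ∀ Bs → increments Bs (λ _ → 0ℚ) z ≡ 0ℚ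
  increments-0 []       = refl
  increments-0 (B ∷ Bs) = cong (0ℚ -ℚ 0ℚ +ℚ_) (increments-0 Bs)
expansion-lowDegree {Bs = Bs} {z = z} dBs zBs (add {g} {h} l l′)
  with expansion-lowDegree dBs zBs l | expansion-lowDegree dBs zBs l′
... | expansion a ea ia | expansion b eb ib = expansion (Vec.zipWith _+ℚ_ a b)
  (λ t → trans (expectation-+ t Bs z) (trans (cong₂ _+ℚ_ (ea t) (eb t))
    (trans (solve 5 (λ p q t x y → (p :+ t :* x) :+ (q :+ t :* y) := p :+ q :+ t :* (x :+ y)) refl
        (g z) (h z) t (horner a t) (horner b t))
      (cong (λ r → g z +ℚ h z +ℚ t *ℚ r) (sym (horner-+ a b t))))))
  (trans (horner-+ a b 0ℚ) (trans (cong₂ _+ℚ_ ia ib) (sym (increments-+ Bs))))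
  where
  open +-*-Solver
  expectation-+ : ∀ t Bs z → expectation t Bs (λ z → g z +ℚ h z) z ≡
                             expectation t Bs g z +ℚ expectation t Bs h z
  expectation-+ t []       z = refl
  expectation-+ t (B ∷ Bs) z = trans
    (cong₂ (λ p q → (1ℚ -ℚ t) *ℚ p +ℚ t *ℚ q) (expectation-+ t Bs z) (expectation-+ t Bs (z ⊕ B)))
    (solve 6 (λ s t p q p′ q′ → s :* (p :+ q) :+ t :* (p′ :+ q′) :=
                                (s :* p :+ t :* p′) :+ (s :* q :+ t :* q′)) refl
      (1ℚ -ℚ t) t (expectation t Bs g z) (expectation t Bs h z)
      (expectation t Bs g (z ⊕ B)) (expectation t Bs h (z ⊕ B)))
  increments-+ : ∀ Bs → increments Bs (λ z → g z +ℚ h z) z ≡ increments Bs g z +ℚ increments Bs h z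
  increments-+ []       = refl
  increments-+ (B ∷ Bs) = trans (cong (g (z ⊕ B) +ℚ h (z ⊕ B) -ℚ (g z +ℚ h z) +ℚ_) (increments-+ Bs))
    (solve 6 (λ p q r s i j → (p :+ q :- (r :+ s)) :+ (i :+ j) := (p :- r :+ i) :+ (q :- s :+ j)) refl
      (g (z ⊕ B)) (h (z ⊕ B)) (g z) (h z) (increments Bs g z) (increments Bs h z))
expansion-lowDegree {Bs = Bs} {z = z} dBs zBs (mul {g} p l)
  with expansion-lowDegree dBs zBs l
... | expansion a ea ia = expansion (Vec.map (p *ℚ_) a)
  (λ t → trans (expectation-* t Bs z) (trans (cong (p *ℚ_) (ea t))
    (trans (solve 4 (λ p q t x → p :* (q :+ t :* x) := p :* q :+ t :* (p :* x)) refl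
        p (g z) t (horner a t))
      (cong (λ r → p *ℚ g z +ℚ t *ℚ r) (sym (horner-* p a t))))))
  (trans (horner-* p a 0ℚ) (trans (cong (p *ℚ_) ia) (sym (increments-* Bs))))
  where
  open +-*-Solver
  expectation-* : ∀ t Bs z → expectation t Bs (λ z → p *ℚ g z) z ≡ p *ℚ expectation t Bs g z
  expectation-* t []       z = refl
  expectation-* t (B ∷ Bs) z = trans
    (cong₂ (λ p q → (1ℚ -ℚ t) *ℚ p +ℚ t *ℚ q) (expectation-* t Bs z) (expectation-* t Bs (z ⊕ B)))
    (solve 5 (λ p s t x y → s :* (p :* x) :+ t :* (p :* y) := p :* (s :* x :+ t :* y)) refl
      p (1ℚ -ℚ t) t (expectation t Bs g z) (expectation t Bs g (z ⊕ B)))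
  increments-* : ∀ Bs → increments Bs (λ z → p *ℚ g z) z ≡ p *ℚ increments Bs g z
  increments-* []       = sym (ℚ.*-zeroʳ p)
  increments-* (B ∷ Bs) = trans (cong (p *ℚ g (z ⊕ B) -ℚ p *ℚ g z +ℚ_) (increments-* Bs))
    (solve 4 (λ p a b i → (p :* a :- p :* b) :+ p :* i := p :* (a :- b :+ i)) refl
      p (g (z ⊕ B)) (g z) (increments Bs g z))
expansion-lowDegree {Bs = Bs} {z = z} dBs zBs (ext {g} g≗h l)
  with expansion-lowDegree dBs zBs l
... | expansion a ea ia = expansion a
  (λ t → trans (sym (expectation-cong t Bs g≗h z)) (trans (ea t) (cong (_+ℚ t *ℚ horner a t) (g≗h z))))
  (trans ia (increments-cong Bs g≗h z))

module _ (f : BooleanFunction n) (x : Cube n) where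

  private
    value : Cube n → ℚ
    value z = toℚ (f (x ⊕ z))

    origin : Cube n
    origin = replicate n false

  disjoint-origin : ∀ B → Disjoint origin B
  disjoint-origin B = disjoint⁺ λ i i∈ _ → contradiction (trans (sym i∈) (lookup-replicate i false)) λ ()

  value-bounded : Bounded value
  value-bounded z with f (x ⊕ z)
  ... | false = ι-mono-≤ {0} {0} z≤n , ι-mono-≤ {0} {1} z≤n
  ... | true  = ι-mono-≤ {0} {1} z≤n , ι-mono-≤ {1} {1} ℕ.≤-refl

  -- Every sensitive block changes the value at `x` by the same amount 1 or -1, so nothing cancels
  -- in the sum.
  increments-sensitive : ∀ Bs → All (Sensitive f x) Bs →
    increments Bs value origin ≡ ι (length Bs) *ℚ (toℚ (not (f x)) -ℚ toℚ (f x))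
  increments-sensitive [] [] = sym (ℚ.*-zeroˡ (toℚ (not (f x)) -ℚ toℚ (f x)))
  increments-sensitive (B ∷ Bs) (s ∷ ss) = begin
    (value (origin ⊕ B) -ℚ value origin) +ℚ increments Bs value origin
      ≡⟨ cong₂ (λ b c → (toℚ b -ℚ toℚ c) +ℚ increments Bs value origin)
           (trans (cong (λ z → f (x ⊕ z)) (⊕-identityˡ B)) (Bool.¬-not s)) (cong f (⊕-identityʳ x)) ⟩
    δ +ℚ increments Bs value origin   ≡⟨ cong (δ +ℚ_) (increments-sensitive Bs ss) ⟩
    δ +ℚ ι (length Bs) *ℚ δ           ≡⟨ solve 2 (λ d l → d :+ l :* d := (l :+ con 1ℚ) :* d) refl δ (ι (length Bs)) ⟩
    (ι (length Bs) +ℚ 1ℚ) *ℚ δ        ≡⟨ cong (_*ℚ δ) (ι-suc (length Bs)) ⟨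
    ι (suc (length Bs)) *ℚ δ          ∎
    where
    open ≡-Reasoning
    open +-*-Solver
    δ = toℚ (not (f x)) -ℚ toℚ (f x)
    ⊕-identityˡ : ∀ (B : Subset n) → origin ⊕ B ≡ B
    ⊕-identityˡ = Vec.zipWith-identityˡ Bool.xor-identityˡ

  -- bs(f,x) ≤ 2 deg³, by interpolating the quotient of the expectation.
  blocks≤2m³ : ∀ m → (∀ T → m < ∥ T ∥ → alternating T value ≡ 0ℚ) →
               ∀ Bs → DisjointSensitive f x Bs → length Bs ≤ 2 * m * (m * m)
  blocks≤2m³ m high Bs (ss , ds) = ι-cancel-≤ (subst (_≤ℚ ι (2 * m * (m * m))) ∣h0∣ (bound m a bounded))
    where
    E : Expansion m Bs value origin
    E = expansion-lowDegree ds (All.tabulate λ {B} _ → disjoint-origin B) (lowDegree (suc m) value high)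
    a = Expansion.quotient E
    ∣δ∣ : ∀ b → ∣ toℚ (not b) -ℚ toℚ b ∣ ≡ 1ℚ
    ∣δ∣ false = refl
    ∣δ∣ true  = refl
    ∣h0∣ : ∣ horner a 0ℚ ∣ ≡ ι (length Bs)
    ∣h0∣ = trans (cong ∣_∣ (trans (Expansion.increments≡ E) (increments-sensitive Bs ss)))
      (trans (ℚ.∣p*q∣≡∣p∣*∣q∣ (ι (length Bs)) (toℚ (not (f x)) -ℚ toℚ (f x)))
        (trans (cong₂ _*ℚ_ (∣ι∣ (length Bs)) (∣δ∣ (f x))) (ℚ.*-identityʳ (ι (length Bs)))))
    ∣p-q∣≤1 : ∀ {p q} → 0ℚ ≤ℚ p × p ≤ℚ 1ℚ → 0ℚ ≤ℚ q × q ≤ℚ 1ℚ → ∣ p -ℚ q ∣ ≤ℚ 1ℚ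
    ∣p-q∣≤1 {p} {q} (0≤p , p≤1) (0≤q , q≤1) with ℚ.∣p∣≡p∨∣p∣≡-p (p -ℚ q)
    ... | inj₁ eq = subst (_≤ℚ 1ℚ) (sym eq) (ℚ.+-mono-≤ p≤1 (ℚ.neg-antimono-≤ 0≤q))
    ... | inj₂ eq = subst (_≤ℚ 1ℚ) (sym (trans eq (solve 2 (λ p q → :- (p :- q) := q :- p) refl p q)))
      (ℚ.+-mono-≤ q≤1 (ℚ.neg-antimono-≤ 0≤p))
      where open +-*-Solver
    bounded : ∀ t → 0ℚ ≤ℚ t → t ≤ℚ 1ℚ → ∣ t *ℚ horner a t ∣ ≤ℚ 1ℚ
    bounded t 0≤t t≤1 = subst (λ p → ∣ p ∣ ≤ℚ 1ℚ)
      (trans (cong (_-ℚ value origin) (Expansion.expectation≡ E t))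
        (solve 2 (λ v h → v :+ h :- v := h) refl (value origin) (t *ℚ horner a t)))
      (∣p-q∣≤1 (expectation-bounded 0≤t t≤1 Bs value-bounded origin) (value-bounded origin))
      where open +-*-Solver
    -- For k = 0 there are no interpolation nodes, but the quotient is then the empty list, with
    -- value 0.
    bound : ∀ k (h : Vec ℚ k) → (∀ t → 0ℚ ≤ℚ t → t ≤ℚ 1ℚ → ∣ t *ℚ horner h t ∣ ≤ℚ 1ℚ) →
            ∣ horner h 0ℚ ∣ ≤ℚ ι (2 * k * (k * k))
    bound zero    [] _ = ℚ.≤-refl
    bound (suc k) h    = ∣horner-0∣≤ h

-- Polynomial bounds

-- Natural coefficients make the polynomial monotone on ℕ, so an upper bound on its argument can be
-- substituted.
hornerℕ : List ℕ → ℕ → ℕ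
hornerℕ []       s = 0
hornerℕ (a ∷ as) s = a + s * hornerℕ as s

hornerℕ-mono-≤ : ∀ as {s t} → s ≤ t → hornerℕ as s ≤ hornerℕ as t
hornerℕ-mono-≤ []       s≤t = z≤n
hornerℕ-mono-≤ (a ∷ as) s≤t = ℕ.+-monoʳ-≤ a (ℕ.*-mono-≤ s≤t (hornerℕ-mono-≤ as s≤t))

IsPolynomial : (ℕ → ℕ) → Set
IsPolynomial g = ∃[ as ] ∀ s → g s ≡ hornerℕ as s

isPolynomial-const : ∀ a → IsPolynomial (λ _ → a)
isPolynomial-const a = a ∷ [] , λ s → sym (trans (cong (a +_) (ℕ.*-zeroʳ s)) (ℕ.+-identityʳ a))

isPolynomial-shift : ∀ {g} → IsPolynomial g → IsPolynomial (λ s → s * g s)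
isPolynomial-shift (as , eq) = 0 ∷ as , λ s → cong (s *_) (eq s)

isPolynomial-id : IsPolynomial id
isPolynomial-id = 0 ∷ 1 ∷ [] , λ s → sym (trans (cong (s *_) (cong suc (ℕ.*-zeroʳ s))) (ℕ.*-identityʳ s))

isPolynomial-+ : ∀ {g h} → IsPolynomial g → IsPolynomial h → IsPolynomial (λ s → g s + h s)
isPolynomial-+ (as , g≗) (bs , h≗) = plus as bs , λ s →
  trans (cong₂ _+_ (g≗ s) (h≗ s)) (sym (plus-correct as bs s))
  where
  plus : List ℕ → List ℕ → List ℕ
  plus []       bs       = bs
  plus (a ∷ as) []       = a ∷ as
  plus (a ∷ as) (b ∷ bs) = a + b ∷ plus as bs
  rearrange : ∀ a b s x y → a + b + s * (x + y) ≡ (a + s * x) + (b + s * y)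
  rearrange = solve-∀
  plus-correct : ∀ as bs s → hornerℕ (plus as bs) s ≡ hornerℕ as s + hornerℕ bs s
  plus-correct []       bs       s = refl
  plus-correct (a ∷ as) []       s = sym (ℕ.+-identityʳ _)
  plus-correct (a ∷ as) (b ∷ bs) s = trans (cong (λ t → a + b + s * t) (plus-correct as bs s))
    (rearrange a b s (hornerℕ as s) (hornerℕ bs s))

isPolynomial-* : ∀ {g h} → IsPolynomial g → IsPolynomial h → IsPolynomial (λ s → g s * h s)
isPolynomial-* {h = h} (as , g≗) h-poly@(bs , h≗) =
  let cs , eq = product as in cs , λ s → trans (cong (_* h s) (g≗ s)) (eq s)
  where
  scale : ∀ a bs s → a * hornerℕ bs s ≡ hornerℕ (map (a *_) bs) s
  scale a []       s = ℕ.*-zeroʳ a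
  scale a (b ∷ bs) s = trans (rearrange a b s (hornerℕ bs s)) (cong (λ t → a * b + s * t) (scale a bs s))
    where
    rearrange : ∀ a b s x → a * (b + s * x) ≡ a * b + s * (a * x)
    rearrange = solve-∀
  product : ∀ as → IsPolynomial (λ s → hornerℕ as s * h s)
  product [] = isPolynomial-const 0
  product (a ∷ as) =
    let cs , eq = isPolynomial-+ (map (a *_) bs , λ s → trans (cong (a *_) (h≗ s)) (scale a bs s))
                                 (isPolynomial-shift (product as))
    in cs , λ s → trans (rearrange a s (hornerℕ as s) (h s)) (eq s)
    where
    rearrange : ∀ a s x y → (a + s * x) * y ≡ a * y + s * (x * y)
    rearrange = solve-∀

isPolynomial-∘ : ∀ as {g} → IsPolynomial g → IsPolynomial (hornerℕ as ∘ g)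
isPolynomial-∘ []       g-poly = isPolynomial-const 0
isPolynomial-∘ (a ∷ as) g-poly =
  isPolynomial-+ (isPolynomial-const a) (isPolynomial-* g-poly (isPolynomial-∘ as g-poly))

seq-eval : ∀ as s n → seq (eval (map fromℕ as) (fromℕ s)) n ≡ ι (hornerℕ as s)
seq-eval []       s n = refl
seq-eval (a ∷ as) s n = trans (cong (λ t → ι a +ℚ ι s *ℚ t) (seq-eval as s n))
  (trans (cong (ι a +ℚ_) (sym (ι-* s (hornerℕ as s)))) (sym (ι-+ a (s * hornerℕ as s))))

≤ι : ∀ p → 0ℚ <ℚ p → ∃[ k ] p ≤ℚ ι k
≤ι (mkℚ ℤ.-[1+ _ ] _ _) (*<* ())
≤ι (mkℚ (ℤ.+ a) d c) _ = a , ℚ.toℚᵘ-cancel-≤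
  (ℚᵘ.≤-respʳ-≃ (ℚᵘ.≃-sym (ℚ.toℚᵘ-fromℚᵘ (ℚᵘ.mkℚᵘ (ℤ.+ a) 0)))
    (ℚᵘ.*≤* (subst₂ ℤ._≤_ (ℤ.pos-* a 1) (ℤ.pos-* a (suc d)) (ℤ.+≤+ (ℕ.*-monoʳ-≤ a (s≤s z≤n))))))

-- Each coefficient, a Cauchy sequence, is eventually below some natural number. The threshold `N`
-- comes from the coefficients alone and so serves all `s` at once.
eventually-≤-hornerℕ : ∀ p → ∃[ as ] ∃[ N ] ∀ s n → n ≥ N → seq (eval p (fromℕ s)) n ≤ℚ ι (hornerℕ as s)
eventually-≤-hornerℕ [] = [] , 0 , λ _ _ _ → ℚ.≤-refl
eventually-≤-hornerℕ (a ∷ p) =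
  let K , K>0 , M , a≤K = eventually-bounded (cauchy a)
      k , K≤k = ≤ι K K>0
      as , N , p≤as = eventually-≤-hornerℕ p
  in k ∷ as , M + N , λ s n n≥ → subst (seq a n +ℚ ι s *ℚ seq (eval p (fromℕ s)) n ≤ℚ_)
       (sym (trans (ι-+ k (s * hornerℕ as s)) (cong (ι k +ℚ_) (ι-* s (hornerℕ as s)))))
       (ℚ.+-mono-≤
         (ℚ.≤-trans (p≤∣p∣ (seq a n)) (ℚ.≤-trans (a≤K n (ℕ.m+n≤o⇒m≤o M n≥)) K≤k))
         (ℚ.*-monoˡ-≤-nonNeg (ι s) {{ι-nonNeg s}} (p≤as s n (ℕ.m+n≤o⇒n≤o M n≥))))
  where
  p≤∣p∣ : ∀ p → p ≤ℚ ∣ p ∣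
  p≤∣p∣ p with ℚ.≤-total 0ℚ p
  ... | inj₁ 0≤p = ℚ.≤-reflexive (sym (ℚ.0≤p⇒∣p∣≡p 0≤p))
  ... | inj₂ p≤0 = ℚ.≤-trans p≤0 (ℚ.0≤∣p∣ p)

-- The order on reals gives the bound only up to ε; between natural numbers an error of ½ is
-- harmless.
polynomial-bound : ∀ p → ∃[ as ] ∀ s {x k} → (∀ n → ι k ≤ℚ seq x n) → x ≤ᴿ eval p (fromℕ s) →
                   k ≤ hornerℕ as s
polynomial-bound p = let as , N , p≤as = eventually-≤-hornerℕ p in as , λ s {x} {k} k≤x x≤p →
  let M , x≤p+½ = ≤-limit x≤p ½ (ℚ.positive⁻¹ ½)
      n = M + N
      k≤as+½ : ι k ≤ℚ ι (hornerℕ as s) +ℚ ½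
      k≤as+½ = ℚ.≤-trans (k≤x n) (ℚ.≤-trans (x≤p+½ n (ℕ.m≤m+n M N))
        (ℚ.+-monoˡ-≤ ½ (p≤as s n (ℕ.m≤n+m N M))))
  in ℕ.≮⇒≥ λ as<k → ℚ.<-irrefl refl (ℚ.<-≤-trans
       (subst (ι (hornerℕ as s) +ℚ ½ <ℚ_) (sym (ι-suc (hornerℕ as s)))
         (ℚ.+-monoʳ-< (ι (hornerℕ as s)) ½<1))
       (ℚ.≤-trans (ι-mono-≤ as<k) k≤as+½))
  where
  ½<1 : ½ <ℚ 1ℚ
  ½<1 = *<* (ℤ.+<+ (s≤s (s≤s z≤n)))

≤ᴿ-pointwise : ∀ {x y} → (∀ n → seq x n ≤ℚ seq y n) → x ≤ᴿ y
≤ᴿ-pointwise {y = y} x≤y = mk≤ λ ε ε>0 → 0 , λ n _ →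
  ℚ.≤-trans (x≤y n) (subst (_≤ℚ seq y n +ℚ ε) (ℚ.+-identityʳ (seq y n))
    (ℚ.+-monoʳ-≤ (seq y n) (ℚ.<⇒≤ ε>0)))

-- The rounded logarithm is exact at powers of two, so every approximant obeys the bound, not only
-- the limit.
log-seq≤ : ∀ {r t} → r ≤ 2 ^ t → ∀ n → log-seq r n ≤ℚ ι t
log-seq≤ {r} {t} r≤2^t n = /-mono ⌊log₂ r ^ suc n ⌋ t n 0 (begin
  ⌊log₂ r ^ suc n ⌋ * 1        ≡⟨ ℕ.*-identityʳ _ ⟩
  ⌊log₂ r ^ suc n ⌋            ≤⟨ ⌊log₂⌋-mono-≤ (ℕ.^-monoˡ-≤ (suc n) r≤2^t) ⟩
  ⌊log₂ (2 ^ t) ^ suc n ⌋      ≡⟨ cong ⌊log₂_⌋ (ℕ.^-*-assoc 2 t (suc n)) ⟩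
  ⌊log₂ 2 ^ (t * suc n) ⌋      ≡⟨ ⌊log₂[2^n]⌋≡n (t * suc n) ⟩
  t * suc n                    ∎)
  where open ℕ.≤-Reasoning

≤log-seq : ∀ {r t} → 2 ^ t ≤ r → ∀ n → ι t ≤ℚ log-seq r n
≤log-seq {r} {t} 2^t≤r n = /-mono t ⌊log₂ r ^ suc n ⌋ 0 n (begin
  t * suc n                    ≡⟨ ⌊log₂[2^n]⌋≡n (t * suc n) ⟨
  ⌊log₂ 2 ^ (t * suc n) ⌋      ≡⟨ cong ⌊log₂_⌋ (ℕ.^-*-assoc 2 t (suc n)) ⟨
  ⌊log₂ (2 ^ t) ^ suc n ⌋      ≤⟨ ⌊log₂⌋-mono-≤ (ℕ.^-monoˡ-≤ (suc n) 2^t≤r) ⟩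
  ⌊log₂ r ^ suc n ⌋            ≡⟨ ℕ.*-identityʳ _ ⟨
  ⌊log₂ r ^ suc n ⌋ * 1        ∎)
  where open ℕ.≤-Reasoning

log₂≤ : ∀ {r t y} → r ≤ 2 ^ t → (∀ n → ι t ≤ℚ seq y n) → log₂ r ≤₋ [ y ]
log₂≤ {zero}  _     _   = NonStrict.⊥₋≤ _
log₂≤ {suc r} {t} r≤2^t t≤y = NonStrict.[ ≤ᴿ-pointwise (λ n → ℚ.≤-trans (log-seq≤ {suc r} {t} r≤2^t n) (t≤y n)) ]

log₂-bound : ∀ p → ∃[ as ] ∀ s {r t} → 2 ^ t ≤ r → log₂ r ≤₋ [ eval p (fromℕ s) ] → t ≤ hornerℕ as s
log₂-bound p = let as , bound = polynomial-bound p in as , λ where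
  s {zero}  {t} 2^t≤0 _ → contradiction 2^t≤0 (ℕ.<⇒≱ (ℕ.m^n>0 2 t))
  s {suc r} {t} 2^t≤r NonStrict.[ le ] → bound s (≤log-seq {suc r} {t} 2^t≤r) le

corollary4p1p5 : (∃[ p ] ∀ (n : ℕ) → n ≥ 1 → (f : BooleanFunction n) →
    fromℕ (blockSensitivity f) ≤ᴿ eval p (fromℕ (sensitivity f)))
    ⇔
    (∃[ q ] ∀ (n : ℕ) → n ≥ 1 → (f : BooleanFunction n) →
    log₂ (rank (xorMatrix f)) ≤₋ [ eval q (fromℕ (sensitivity f)) ])
corollary4p1p5 = mk⇔ forward backward
  where
  forward : _ → _
  forward (p , bs≤p) = map fromℕ (proj₁ D-poly) , λ n n≥1 f →
    let s = sensitivity f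
        bs≤G = bound s {k = blockSensitivity f} (λ _ → ℚ.≤-refl) (bs≤p n n≥1 f)
        C≤ = ℕ.*-monoˡ-≤ s bs≤G
    in log₂≤ {t = D s}
         (ℕ.≤-trans (rank-xorMatrix≤ f) (ℕ.≤-trans (ℕ.^-monoʳ-≤ 4 (ℕ.*-mono-≤ C≤ C≤))
           (ℕ.≤-reflexive (ℕ.^-*-assoc 2 2 (G s * s * (G s * s))))))
         (λ m → ℚ.≤-reflexive (sym (trans (seq-eval (proj₁ D-poly) s m) (cong ι (sym (proj₂ D-poly s))))))
    where
    G = hornerℕ (proj₁ (polynomial-bound p))
    bound = proj₂ (polynomial-bound p)
    -- Certificates have size at most G(s) s, and 4 to the power C² is 2 to the power 2C².
    D : ℕ → ℕ
    D s = 2 * (G s * s * (G s * s))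
    Gs-poly : IsPolynomial (λ s → G s * s)
    Gs-poly = isPolynomial-* (proj₁ (polynomial-bound p) , λ _ → refl) isPolynomial-id
    D-poly : IsPolynomial D
    D-poly = isPolynomial-* (isPolynomial-const 2) (isPolynomial-* Gs-poly Gs-poly)
  backward : _ → _
  backward (q , log≤q) = map fromℕ (proj₁ D-poly) , λ n n≥1 f →
    let s = sensitivity f in ≤ᴿ-pointwise λ m →
    subst (ι (blockSensitivity f) ≤ℚ_)
      (sym (trans (seq-eval (proj₁ D-poly) s m) (cong ι (sym (proj₂ D-poly s)))))
      (ι-mono-≤ (blockSensitivity≤ f λ x → blocks≤2m³ f x (G (2 * s)) λ T G<T →
        decidable-stable (alternating T _ ℚ.≟ 0ℚ) λ coefficient≢0 → ℕ.<⇒≱ G<T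
          (ℕ.≤-trans
            (bound (sensitivity (gadget f x)) (2^≤rank-gadget f x T coefficient≢0)
              (log≤q (n + n) (ℕ.≤-trans n≥1 (ℕ.m≤m+n n n)) (gadget f x)))
            (hornerℕ-mono-≤ (proj₁ (log₂-bound q)) (sensitivity-gadget f x)))))
    where
    G = hornerℕ (proj₁ (log₂-bound q))
    bound = proj₂ (log₂-bound q)
    -- The gadget has sensitivity at most 2s, so G(2s) bounds the degree m of `f` around `x`, and
    -- `blocks≤2m³` gives 2m³.
    D : ℕ → ℕ
    D s = 2 * G (2 * s) * (G (2 * s) * G (2 * s))
    G-poly : IsPolynomial (λ s → G (2 * s))
    G-poly = isPolynomial-∘ (proj₁ (log₂-bound q)) (isPolynomial-* (isPolynomial-const 2) isPolynomial-id)
    D-poly : IsPolynomial D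
    D-poly = isPolynomial-* (isPolynomial-* (isPolynomial-const 2) G-poly) (isPolynomial-* G-poly G-poly)
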